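{- Let $A\subseteq\{0,1\}^*$ be any NP-hard set that is well-pierced. Then there exists a basic junta distribution $\mu=\{\mu_n\}_{n\in\mathbb{N}}$ (for $A$) relative to which $A$ has a basic deterministic heuristic polynomial-time algorithm $\mathcal{A}$; indeed, $\mathcal{A}$ can be taken so that its error weight is bounded not merely by $1/q(n)$ for some polynomial $q$ of degree at least 1 (as the definition requires) but even by $1/2^{n^2-n}$, i.e., there is an $N\in\mathbb{N}$ such that for each $n\ge N$, $$\mathrm{Prob}_{\mu_n}[x\notin A \iff \mathcal{A}\text{ accepts }x]\le \frac{1}{2^{n^2-n}}.$$ Furthermore, the junta $\mu$ is uniformly computable in exponential time, and if we in addition assume that $A$ is uniquely well-pierced, the junta $\mu$ is uniformly computable in polynomial time.
   Context: Strings are over $\{0,1\}$, and $|x|$ is the length of $x$. A distribution here is a family $\mu=\{\mu_n\}_{n\in\mathbb{N}}$, where each $\mu_n$ is a probability distribution over the strings of length $n$ (the weights sum to 1 at each length $n$). $\mathrm{Prob}_{\mu_n}[\cdot]$ is the probability when $x$ with $|x|=n$ is drawn according to $\mu_n$. Well-pierced: a set $L$ is well-pierced (respectively, uniquely well-pierced) if there exist sets $Pos\in\mathrm{P}$ and $Neg\in\mathrm{P}$ such that $Pos\subseteq L$, $Neg\subseteq\overline{L}$, and there is some $N\in\mathbb{N}$ such that at each length $n\ge N$, each of $Pos$ and $Neg$ has at least one string of length $n$ (respectively, each of $Pos$ and $Neg$ has exactly one string of length $n$). Basic junta distribution: for an NP-hard problem $L$, a distribution $\mu=\{\mu_n\}_{n\in\mathbb{N}}$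 over the possible instances of $L$ is a basic junta distribution if: (a) Hardness: the restriction of $L$ to $\mu$, i.e., the problem whose possible instances are only $\bigcup_{n\in\mathbb{N}}\{x\mid |x|=n\text{ and }\mu_n(x)>0\}$, is still NP-hard to decide. (b) Balance: there exist constants $c>1$ and $N\in\mathbb{N}$ such that for all $n\ge N$, with $x$ ranging over instances of length $n$, $1/c\le\mathrm{Prob}_{\mu_n}[x\in L]\le 1-1/c$. (c) Dichotomy: there exists a polynomial $p$ such that for all $n$ and all instances $x$ with $|x|=n$, either $\mu_n(x)\ge 2^{ -p(n)}$ or $\mu_n(x)=0$. Basic deterministic heuristic polynomial-time algorithm: an algorithm $\mathcal{A}$ is such an algorithm for $(L,\mu)$ (equivalently, for $L$ relative to $\mu$) if $\mu$ is a basic junta distribution for $L$, $\mathcal{A}$ is a deterministic polynomial-time algorithm, and there exist a polynomial $q$ of degree at least 1 and an $N\in\mathbb{N}$ such that for each $n\ge N$, $\mathrm{Prob}_{\mu_n}[x\notin L\iff\mathcal{A}\text{ accepts }x]<\frac{1}{q(n)}$. Uniform computability: $\mu=\{\mu_n\}_{n\in\mathbb{N}}$ is uniformly computable in polynomial time (respectively, exponential time) if there is a polynomial-time (respectively, exponential-time) computable function $f$ such that for each $i$ and each $x$, $f(i,x)$ outputs the value $\mu_i(x)$ as a rational number. -}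

module Defs where

open import Data.Bool.Base using (Bool; true; false; if_then_else_)
open import Data.Fin.Base using (Fin)
import Data.Integer.Base as ℤ
open import Data.List.Base using (List; []; _∷_; _++_; map; concatMap; length; drop)
open import Data.List.Relation.Unary.All using (All; []; _∷_)
open import Data.List.Relation.Unary.Any using (Any)
open import Data.Maybe.Base using (Maybe; just; nothing)
open import Data.Nat.Base using (ℕ; zero; suc; _+_; _*_; _^_; _≤_; NonZero)
open import Data.Nat.Binary.Base using (ℕᵇ; 2[1+_]; 1+[2_]; fromℕ)
open import Data.Nat.Properties using (m^n≢0)
open import Data.Product.Base using (Σ-syntax; ∃; ∃-syntax; _×_; _,_; proj₁; proj₂)
open import Data.Product using (∃!)
open import Data.Rational.Base as ℚ using (ℚ; 0ℚ; 1ℚ)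
open import Data.Rational.Properties as ℚ using ()
open import Data.Sum.Base using (_⊎_)
open import Data.Vec.Base as Vec using (Vec)
open import Function.Base using (id; _∘_)
open import Function.Bundles using (_↔_; _⇔_)
open import Level using (0ℓ)
open import Relation.Binary.PropositionalEquality using (_≡_; refl; cong₂)
open import Relation.Nullary using (¬_; Dec; does)
open import Relation.Nullary.Decidable using (does-≡; ¬¬-excluded-middle)
open import Relation.Unary using (Pred; U; ∁; _⊆_)

String : Set
String = List Bool

Language : Set₁
Language = Pred String 0ℓ

-- Self-delimiting: the bits of u are doubled and terminated by 01.
pair : String → String → String
pair u v = concatMap (λ b → b ∷ b ∷ []) u ++ false ∷ true ∷ v

-- ℕᵇ is bijective base-2 notation, so this is the usual identification of
-- ℕ with {0,1}*, least significant digit first (digit 1 is the bit false,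
-- digit 2 is the bit true).
bits : ℕᵇ → String
bits ℕᵇ.zero  = []
bits 1+[2 n ] = false ∷ bits n
bits 2[1+ n ] = true ∷ bits n

encodeℕ : ℕ → String
encodeℕ = bits ∘ fromℕ

encodeℕ×String : ℕ × String → String
encodeℕ×String (i , x) = pair (encodeℕ i) x

encodeℕ×ℕ : ℕ × ℕ → String
encodeℕ×ℕ (a , b) = pair (encodeℕ a) (encodeℕ b)

-- Coefficients in ℕ, constant term first.
Poly : Set
Poly = List ℕ

eval : Poly → ℕ → ℕ
eval []      n = 0
eval (a ∷ p) n = a + n * eval p n

Degree≥1 : Poly → Set
Degree≥1 p = Any NonZero (drop 1 p)

-- nothing is the blank.
Symbol : Set
Symbol = Maybe Bool

data Move : Set where
  left stay right : Move

-- A two-way infinite tape.  Both sides are listed from the head outwards;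
-- all cells beyond the lists are blank.
record Tape : Set where
  constructor tape
  field
    before : List Symbol
    head   : Symbol
    after  : List Symbol

open Tape public

-- Blanks are not stored at the far end of a half-tape, so that tapes with
-- equal contents stay equal.
infixr 5 _◂_
_◂_ : Symbol → List Symbol → List Symbol
nothing ◂ [] = []
s       ◂ ss = s ∷ ss

-- Write a symbol, then move the head.
act : Symbol × Move → Tape → Tape
act (s , stay)  (tape ls       _ rs)       = tape ls s rs
act (s , left)  (tape []       _ rs)       = tape [] nothing (s ◂ rs)
act (s , left)  (tape (l ∷ ls) _ rs)       = tape ls l (s ◂ rs)
act (s , right) (tape ls       _ [])       = tape (s ◂ ls) nothing []
act (s , right) (tape ls       _ (r ∷ rs)) = tape (s ◂ ls) r rs

blankTape : Tape
blankTape = tape [] nothing []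

inputTape : String → Tape
inputTape []      = blankTape
inputTape (b ∷ x) = tape [] (just b) (map just x)

leadingBits : List Symbol → String
leadingBits (just b ∷ ss) = b ∷ leadingBits ss
leadingBits _             = []

-- The bits from the head rightwards up to the first blank.
readTape : Tape → String
readTape t = leadingBits (head t ∷ after t)

record TM : Set₁ where
  field
    extraTapes : ℕ

  tapes : ℕ
  tapes = suc extraTapes

  field
    State  : Set
    finite : ∃[ m ] (State ↔ Fin m)
    start  : State
    accept : State → Bool
    -- nothing means that the machine halts.
    δ      : State → Vec Symbol tapes → Maybe (State × Vec (Symbol × Move) tapes)

  record Config : Set where
    eta-equality
    constructor config
    field
      state    : State
      contents : Vec Tape tapes

  open Config public

  initial : String → Config
  initial x = config start (inputTape x Vec.∷ Vec.replicate extraTapes blankTape)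

  step : Config → Maybe Config
  step (config q ts) with δ q (Vec.map head ts)
  ... | nothing       = nothing
  ... | just (q′ , a) = just (config q′ (Vec.zipWith act a ts))

  -- c ⇓[ t ] d : started in c, the machine halts in d after exactly t steps.
  infix 4 _⇓[_]_
  data _⇓[_]_ : Config → ℕ → Config → Set where
    halt : ∀ {c} → step c ≡ nothing → c ⇓[ 0 ] c
    next : ∀ {c c′ d t} → step c ≡ just c′ → c′ ⇓[ t ] d → c ⇓[ suc t ] d

  output : Config → String
  output c = readTape (Vec.head (contents c))

  Accepts : Language
  Accepts x = ∃[ t ] ∃[ d ] (initial x ⇓[ t ] d × accept (state d) ≡ true)

  RunsInTime : (ℕ → ℕ) → Set
  RunsInTime T = ∀ x → ∃[ t ] ∃[ d ] (t ≤ T (length x) × initial x ⇓[ t ] d)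

open TM public using (Accepts; RunsInTime)

PolynomialTime : TM → Set
PolynomialTime M = ∃[ p ] RunsInTime M (eval p)

-- Inputs and outputs are presented to the machine through the given
-- encodings; time is measured in the length of the encoded input.
ComputableInTime : {X Y : Set} → (ℕ → ℕ) → (X → String) → (Y → String) →
                   (X → Y) → Set₁
ComputableInTime T encX encY f = Σ[ M ∈ TM ] let open TM M in
  ∀ a → ∃[ t ] ∃[ d ] (t ≤ T (length (encX a)) × initial (encX a) ⇓[ t ] d ×
                       output d ≡ encY (f a))

InP : Language → Set₁
InP L = Σ[ M ∈ TM ] (PolynomialTime M × (∀ x → L x ⇔ Accepts M x))

InNP : Language → Set₁
InNP L = Σ[ R ∈ Language ] ∃[ p ] (InP R ×
  (∀ x → L x ⇔ (∃[ y ] (length y ≤ eval p (length x) × R (pair x y)))))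

-- NP-hardness, under polynomial-time many-one reductions, of deciding L on
-- the instances I: reductions may only produce instances in I.
NPHardOn : (I L : Language) → Set₁
NPHardOn I L = ∀ (B : Language) → InNP B →
  Σ[ f ∈ (String → String) ]
    ((∃[ p ] ComputableInTime (eval p) id id f) ×
     (∀ x → I (f x) × (B x ⇔ L (f x))))

NPHard : Language → Set₁
NPHard = NPHardOn U

PiercedBy : ((String → Set) → Set) → Language → Set₁
PiercedBy Q L = Σ[ Pos ∈ Language ] Σ[ Neg ∈ Language ]
  (InP Pos × InP Neg × Pos ⊆ L × Neg ⊆ ∁ L ×
   (∃[ N ] ∀ n → N ≤ n →
      Q (λ x → length x ≡ n × Pos x) × Q (λ x → length x ≡ n × Neg x)))

WellPierced : Language → Set₁
WellPierced = PiercedBy ∃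

UniquelyWellPierced : Language → Set₁
UniquelyWellPierced = PiercedBy (∃! _≡_)

-- All strings of length n, each exactly once.
strings : ℕ → List String
strings zero    = [] ∷ []
strings (suc n) = map (false ∷_) (strings n) ++ map (true ∷_) (strings n)

sum : (String → ℚ) → List String → ℚ
sum w []       = 0ℚ
sum w (x ∷ xs) = w x ℚ.+ sum w xs

record Distribution : Set where
  field
    μ           : ℕ → String → ℚ
    nonNegative : ∀ n x → 0ℚ ℚ.≤ μ n x
    offLength   : ∀ n x → ¬ (length x ≡ n) → μ n x ≡ 0ℚ
    total       : ∀ n → sum (μ n) (strings n) ≡ 1ℚ

open Distribution public

-- The total weight of those members of xs that lie in E.
weight : (String → ℚ) → {E : Language} → ∀ {xs} → All (λ x → Dec (E x)) xs → ℚ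
weight w []                 = 0ℚ
weight w (_∷_ {x = x} d ds) = (if does d then w x else 0ℚ) ℚ.+ weight w ds

-- Prob D n E Q says that the probability of E under the n-th distribution
-- satisfies Q.  E need not be computable, so membership in E on the finitely
-- many strings of length n is a classical case distinction.  By the next two
-- lemmas such a case distinction can never be refuted, and its choice does
-- not affect the value; so this is the usual meaning for every Q with
-- ¬ ¬ Q r → Q r, in particular for the order relations on ℚ.
Prob : Distribution → ℕ → Language → (ℚ → Set) → Set
Prob D n E Q = (E? : All (λ x → Dec (E x)) (strings n)) → Q (weight (μ D n) E?)

decisions-irrefutable : (E : Language) → ∀ xs → ¬ ¬ All (λ x → Dec (E x)) xs
decisions-irrefutable E []       k = k []
decisions-irrefutable E (x ∷ xs) k =
  ¬¬-excluded-middle λ d → decisions-irrefutable E xs λ ds → k (d ∷ ds)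

weight-unique : ∀ w {E : Language} {xs} (ds ds′ : All (λ x → Dec (E x)) xs) →
                weight w ds ≡ weight w ds′
weight-unique w []                 []         = refl
weight-unique w (_∷_ {x = x} d ds) (d′ ∷ ds′) =
  cong₂ (λ b r → (if b then w x else 0ℚ) ℚ.+ r) (does-≡ d d′) (weight-unique w ds ds′)

1/ℕ : (n : ℕ) → NonZero n → ℚ
1/ℕ n nz = (ℤ.+ 1 ℚ./ n) {{nz}}

1/2^_ : ℕ → ℚ
1/2^ m = 1/ℕ (2 ^ m) (m^n≢0 2 m)

1/⟨_⟩ : ∀ {c} → 1ℚ ℚ.< c → ℚ
1/⟨_⟩ {c} 1<c = (ℚ.1/ c) {{ℚ.>-nonZero (ℚ.<-trans (ℚ.positive⁻¹ 1ℚ) 1<c)}}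

Instances : Distribution → Language
Instances D x = ∃[ n ] (length x ≡ n × 0ℚ ℚ.< μ D n x)

record BasicJunta (L : Language) (D : Distribution) : Set₁ where
  field
    hardness  : NPHardOn (Instances D) L
    balance   : ∃[ c ] Σ[ 1<c ∈ 1ℚ ℚ.< c ] ∃[ N ] ∀ n → N ≤ n →
                Prob D n L (λ r → 1/⟨ 1<c ⟩ ℚ.≤ r × r ℚ.≤ 1ℚ ℚ.- 1/⟨ 1<c ⟩)
    dichotomy : ∃[ p ] ∀ n x → length x ≡ n →
                1/2^ eval p n ℚ.≤ μ D n x ⊎ μ D n x ≡ 0ℚ

Errs : Language → TM → Language
Errs L M x = (¬ L x) ⇔ Accepts M x

record BasicHeuristic (L : Language) (D : Distribution) (M : TM) : Set₁ where
  field
    junta          : BasicJunta L D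
    polynomialTime : PolynomialTime M
    smallError     : ∃[ q ] (Degree≥1 q × (∃[ N ] ∀ n → N ≤ n →
                     Σ[ nz ∈ NonZero (eval q n) ]
                       Prob D n (Errs L M) (ℚ._< 1/ℕ (eval q n) nz)))

-- The rational value is output as a numerator and a denominator, not
-- necessarily in lowest terms.
UniformlyComputableInTime : (ℕ → ℕ) → Distribution → Set₁
UniformlyComputableInTime T D = Σ[ f ∈ (ℕ × String → ℕ × ℕ) ]
  (ComputableInTime T encodeℕ×String encodeℕ×ℕ f ×
   (∀ i x → Σ[ nz ∈ NonZero (proj₂ (f (i , x))) ]
      μ D i x ≡ (ℤ.+ proj₁ (f (i , x)) ℚ./ proj₂ (f (i , x))) {{nz}}))

UniformlyPolynomialTime : Distribution → Set₁
UniformlyPolynomialTime D = ∃[ p ] UniformlyComputableInTime (eval p) D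

UniformlyExponentialTime : Distribution → Set₁
UniformlyExponentialTime D = ∃[ p ] UniformlyComputableInTime (λ n → 2 ^ eval p n) D

{-# OPTIONS --safe #-}
-- Fix n ≥ N.  Let p be the last string of length n in Pos and q the last one in Neg, in the
-- order given by binary counting.  Give p and q weight K/D each and every other string of length n
-- weight 1/D, where K = 2^(n²+n+1) and D = 2K + 2^n - 2; for n < N take the uniform distribution.
-- All strings have positive weight, so hardness is inherited from A.  The machine for Pos is right
-- on p ∈ A and on q ∉ A, so it errs with probability less than 2^n/D ≤ 2^(n-n²).  In bijective base 2,
-- K and D consist of runs of equal digits, so a weight is easy to print once it is known whether x
-- is p or q.  This is decided by an exhaustive search over the strings after x, or, if Pos and Neg
-- have a single string of length n, by one run of each machine.
module Submission where

open import Defs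
open import Data.Nat.Base using (ℕ; _≤_; _∸_; _^_)
open import Data.Product.Base using (Σ-syntax; ∃-syntax; _×_)
import Data.Rational.Base as ℚ

open import Data.Bool.Base using (Bool; true; false; if_then_else_; not; T; _∧_; _∨_)
import Data.Bool.Properties as Bool
open import Data.Fin.Base using (Fin; zero; suc; _↑ˡ_)
open import Data.Fin.Patterns using (0F; 1F; 2F; 3F; 4F)
open import Data.Fin.Properties using (+↔⊎; 1↔⊤; 2↔Bool)
import Data.Integer.Base as ℤ
import Data.Integer.Properties as ℤ
open import Data.List.Base as List using (List; []; _∷_; _++_; length; reverse; _ʳ++_)
open import Data.List.Membership.Propositional using (_∈_)
open import Data.List.Membership.Propositional.Properties using (∈-++⁺ˡ; ∈-++⁺ʳ; ∈-map⁺)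
open import Data.List.Properties
open import Data.List.Relation.Unary.All as ListAll using ([]; _∷_)
import Data.List.Relation.Unary.All.Properties as ListAll
open import Data.List.Relation.Unary.Any using (here; there)
open import Data.Maybe.Base as Maybe using (Maybe; just; nothing)
open import Data.Nat.Base
open import Data.Nat.Binary.Base as ℕᵇ using (ℕᵇ; 2[1+_]; 1+[2_]; fromℕ')
open import Data.Nat.Binary.Properties using (fromℕ≡fromℕ'; toℕ-fromℕ; toℕ-fromℕ'; fromℕ-toℕ)
open import Data.Nat.Properties
open import Data.Nat.Tactic.RingSolver using (solve-∀)
open import Data.Product.Base using (Σ; _,_; proj₁; proj₂; map₁; uncurry)
open import Data.Rational.Base using (ℚ; 0ℚ; 1ℚ)
import Data.Rational.Properties as ℚ
import Data.Rational.Unnormalised.Base as ℚᵘ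
import Data.Rational.Unnormalised.Properties as ℚᵘ
open import Data.Sum.Base using (_⊎_; inj₁; inj₂; [_,_]′) renaming (map to ⊎-map)
open import Data.Sum.Function.Propositional using (_⊎-↔_)
open import Data.Unit.Base using (⊤; tt)
open import Data.Vec.Base as Vec using (Vec; []; _∷_; lookup; _[_]≔_; replicate; zipWith)
open import Data.Vec.Properties using (lookup-++ˡ; []≔-++-↑ˡ; lookup-map; map-[]≔; lookup∘update; []≔-idempotent)
open import Data.Vec.Relation.Unary.All using (All; []; _∷_)
open import Function.Base using (_∘_; id; const)
open import Function.Bundles using (_↔_; mk↔ₛ′; Equivalence)
open import Function.Properties.Inverse using (↔-sym; ↔-trans)
open import Relation.Binary.Definitions using (tri<; tri≈; tri>)
open import Relation.Binary.PropositionalEquality hiding ([_])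
open import Relation.Nullary using (¬_; Dec; yes; no; does; contradiction; ¬?)

-- At one length, Pos and Neg may contain exponentially many strings. If all of them were heavy, the
-- total mass would depend on their number, which would then have to be computed. One chosen string
-- on each side keeps the total a closed formula in n. Taking the last one suits the search: it
-- starts at x, counts upwards and stops at the overflow. K meets three demands: K ≥ 2^n leaves each
-- heavy string with probability at least 1/4, so the distribution is balanced with c = 4; D ≥
-- 2^(n+n²) makes all light strings together negligible; and D ≤ 2^(n²+n+3) gives the dichotomy.
-- Most of the work comes from uniform computability. A concrete Turing machine has to print the
-- weights, calling two unknown machines as subroutines, and in the search it does so many times.
-- Such a machine leaves unknown contents around unknown head positions, so its tapes must be
-- blanked before the next call. A clock that records the running time makes this possible.

private variable e : ℕ

Action : ℕ → Set
Action e = Vec (Symbol × Move) (suc e)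

-- Turing machines

-- A machine with a three-valued verdict in its final state, so that machines can be chained.
record Frag (e : ℕ) : Set₁ where
  field
    State  : Set
    finite : ∃[ m ] (State ↔ Fin m)
    start  : State
    exit   : State → Symbol
    δ      : State → Vec Symbol (suc e) → Maybe (State × Action e)

open Frag

isYes : Symbol → Bool
isYes (just true) = true
isYes _           = false

machine : Frag e → TM
machine {e} F = record
  { extraTapes = e ; State = State F ; finite = finite F ; start = start F
  ; accept = isYes ∘ exit F ; δ = δ F }

Tapes : ℕ → Set
Tapes e = Vec Tape (suc e)

module _ (F : Frag e) where
  open TM (machine F) using (config; step; _⇓[_]_; halt; next)

  infix 4 _⟶[_]_
  _⟶[_]_ : State F × Tapes e → ℕ → State F × Tapes e → Set
  (q , ts) ⟶[ t ] (q′ , ts′) = config q ts ⇓[ t ] config q′ ts′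

  halt-at : ∀ {q ts} → δ F q (Vec.map head ts) ≡ nothing → (q , ts) ⟶[ 0 ] (q , ts)
  halt-at {q} {ts} eq = halt stuck
    where
    stuck : step (config q ts) ≡ nothing
    stuck rewrite eq = refl

  next-at : ∀ {q ts q′ a t c} → δ F q (Vec.map head ts) ≡ just (q′ , a) →
            (q′ , zipWith act a ts) ⟶[ t ] c → (q , ts) ⟶[ suc t ] c
  next-at {q} {ts} {q′} {a} eq r = next moves r
    where
    moves : step (config q ts) ≡ just (config q′ (zipWith act a ts))
    moves rewrite eq = refl

  -- `step` hides its case distinction on `δ`. This view recovers an equation about `δ`, which is
  -- the form in which the combined machines below are analysed.
  data Step (q : State F) (ts : Tapes e) : ℕ → State F × Tapes e → Set where
    stops : δ F q (Vec.map head ts) ≡ nothing → Step q ts 0 (q , ts)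
    moves : ∀ {q′ a t c} → δ F q (Vec.map head ts) ≡ just (q′ , a) →
            (q′ , zipWith act a ts) ⟶[ t ] c → Step q ts (suc t) c

  view : ∀ {q ts t c} → (q , ts) ⟶[ t ] c → Step q ts t c
  view {q} {ts} (halt eq) with δ F q (Vec.map head ts) in δ≡
  ... | nothing = stops δ≡
  view {q} {ts} (next eq r) with δ F q (Vec.map head ts) in δ≡
  view (next refl r) | just _ = moves δ≡ r

keep : ∀ {n} → Vec Symbol n → Vec (Symbol × Move) n
keep = Vec.map (_, stay)

keep-act : ∀ {n} (ts : Vec Tape n) → zipWith act (keep (Vec.map head ts)) ts ≡ ts
keep-act []       = refl
keep-act (t ∷ ts) = cong (t ∷_) (keep-act ts)

Finite : Set → Set
Finite A = ∃[ m ] (A ↔ Fin m)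

finite-⊤ : Finite ⊤
finite-⊤ = 1 , ↔-sym 1↔⊤

finite-Bool : Finite Bool
finite-Bool = 2 , ↔-sym 2↔Bool

finite-⊎ : ∀ {A B} → Finite A → Finite B → Finite (A ⊎ B)
finite-⊎ (m , f) (n , g) = m + n , ↔-trans (f ⊎-↔ g) (↔-sym +↔⊎)

finite-via : ∀ {A B} → A ↔ B → Finite B → Finite A
finite-via f (n , g) = n , ↔-trans f g

finite-Maybe : ∀ {A} → Finite A → Finite (Maybe A)
finite-Maybe f = finite-via
  (mk↔ₛ′ (λ { nothing → inj₁ tt ; (just a) → inj₂ a })
         (λ { (inj₁ _) → nothing ; (inj₂ a) → just a })
         (λ { (inj₁ _) → refl ; (inj₂ _) → refl })
         (λ { nothing → refl ; (just _) → refl }))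
  (finite-⊎ finite-⊤ f)

finite-Σ : (B : Symbol → Set) → (∀ s → Finite (B s)) → Finite (Σ Symbol B)
finite-Σ B f = finite-via
  (mk↔ₛ′ (λ { (nothing , b) → inj₁ b ; (just true , b) → inj₂ (inj₁ b) ; (just false , b) → inj₂ (inj₂ b) })
         (λ { (inj₁ b) → nothing , b ; (inj₂ (inj₁ b)) → just true , b ; (inj₂ (inj₂ b)) → just false , b })
         (λ { (inj₁ _) → refl ; (inj₂ (inj₁ _)) → refl ; (inj₂ (inj₂ _)) → refl })
         (λ { (nothing , _) → refl ; (just true , _) → refl ; (just false , _) → refl }))
  (finite-⊎ (f nothing) (finite-⊎ (f (just true)) (f (just false))))

module _ (F : Frag e) (K : Symbol → Frag e) where

  -- The handover takes one step that rewrites the scanned symbols in place, hence the `suc u` in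
  -- `bind-runs`. The verdict is stored in the state because each verdict may continue with a
  -- different machine.
  bindδ : State F ⊎ Σ Symbol (State ∘ K) → Vec Symbol (suc e) →
          Maybe ((State F ⊎ Σ Symbol (State ∘ K)) × Action e)
  bindδ (inj₁ q) hs with δ F q hs
  ... | nothing       = just (inj₂ (exit F q , start (K (exit F q))) , keep hs)
  ... | just (q′ , a) = just (inj₁ q′ , a)
  bindδ (inj₂ (s , q)) hs = Maybe.map (map₁ (inj₂ ∘ (s ,_))) (δ (K s) q hs)

  bindFrag : Frag e
  bindFrag = record
    { State  = State F ⊎ Σ Symbol (State ∘ K)
    ; finite = finite-⊎ (finite F) (finite-Σ (State ∘ K) (finite ∘ K))
    ; start  = inj₁ (start F)
    -- A placeholder for `inj₁`: `bindδ` never halts there.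
    ; exit   = λ { (inj₁ _) → nothing ; (inj₂ (s , q)) → exit (K s) q }
    ; δ      = bindδ }

  bind-inj₂ : ∀ {s q q′ ts ts′ t} → _⟶[_]_ (K s) (q , ts) t (q′ , ts′) →
              _⟶[_]_ bindFrag (inj₂ (s , q) , ts) t (inj₂ (s , q′) , ts′)
  bind-inj₂ {s} r with view (K s) r
  ... | stops eq   = halt-at bindFrag (cong (Maybe.map _) eq)
  ... | moves eq r′ = next-at bindFrag (cong (Maybe.map _) eq) (bind-inj₂ r′)

  bindδ-leave : ∀ {q hs} → δ F q hs ≡ nothing →
                bindδ (inj₁ q) hs ≡ just (inj₂ (exit F q , start (K (exit F q))) , keep hs)
  bindδ-leave eq rewrite eq = refl

  bindδ-step : ∀ {q hs q′ a} → δ F q hs ≡ just (q′ , a) → bindδ (inj₁ q) hs ≡ just (inj₁ q′ , a)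
  bindδ-step eq rewrite eq = refl

  bind-inj₁ : ∀ {q ts t q′ ts′ u c} → _⟶[_]_ F (q , ts) t (q′ , ts′) →
              _⟶[_]_ bindFrag (inj₂ (exit F q′ , start (K (exit F q′))) , ts′) u c →
              _⟶[_]_ bindFrag (inj₁ q , ts) (t + suc u) c
  bind-inj₁ {q} {ts} {u = u} {c = c} r k with view F r
  ... | stops eq    = next-at bindFrag (bindδ-leave eq) (subst (λ ts → _⟶[_]_ bindFrag (_ , ts) u c) (sym (keep-act ts)) k)
  ... | moves eq r′ = next-at bindFrag (bindδ-step eq) (bind-inj₁ r′ k)

module _ (F : Frag e) where

  loopδ : State F → Vec Symbol (suc e) → Maybe (State F × Action e)
  loopδ q hs with δ F q hs | exit F q
  ... | just m  | _         = just m
  ... | nothing | just true = just (start F , keep hs)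
  ... | nothing | _         = nothing

  loopFrag : Frag e
  loopFrag = record
    { State = State F ; finite = finite F ; start = start F ; exit = exit F ; δ = loopδ }

  loopδ-step : ∀ {q hs m} → δ F q hs ≡ just m → loopδ q hs ≡ just m
  loopδ-step eq rewrite eq = refl

  loopδ-again : ∀ {q hs} → δ F q hs ≡ nothing → exit F q ≡ just true →
                loopδ q hs ≡ just (start F , keep hs)
  loopδ-again eq x rewrite eq | x = refl

  -- The continuation is told that the body is stuck, because `loopδ` acts on the verdict only in
  -- that case.
  loop-lift : ∀ {q ts t q′ ts′ u c} → _⟶[_]_ F (q , ts) t (q′ , ts′) →
              (δ F q′ (Vec.map head ts′) ≡ nothing → _⟶[_]_ loopFrag (q′ , ts′) u c) →
              _⟶[_]_ loopFrag (q , ts) (t + u) c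
  loop-lift r k with view F r
  ... | stops eq    = k eq
  ... | moves eq r′ = next-at loopFrag (loopδ-step eq) (loop-lift r′ k)

-- bind chooses the continuation by the verdict of the first part; loop repeats its body as long as
-- the verdict is just true.
data Code (e : ℕ) : Set₁ where
  frag : Frag e → Code e
  ret  : Symbol → Code e
  prim : (Vec Symbol (suc e) → Symbol × Action e) → Code e
  bind : Code e → (Symbol → Code e) → Code e
  loop : Code e → Code e

compile : Code e → Frag e
compile (frag F)   = F
compile (ret s)    = record
  { State = ⊤ ; finite = finite-⊤ ; start = tt ; exit = const s ; δ = λ _ _ → nothing }
compile (prim g)   = record
  { State = Maybe Symbol ; finite = finite-Maybe (finite-Maybe finite-Bool) ; start = nothing
  ; exit = λ { nothing → nothing ; (just s) → s }
  ; δ = λ { nothing hs → just (map₁ just (g hs)) ; (just _) _ → nothing } }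
compile (bind C K) = bindFrag (compile C) (compile ∘ K)
compile (loop C)   = loopFrag (compile C)

record Runs (C : Code e) (ts : Tapes e) (t : ℕ) (s : Symbol) (ts′ : Tapes e) : Set where
  constructor runs
  field
    {time}  : ℕ
    {final} : State (compile C)
    time≤   : time ≤ t
    run     : _⟶[_]_ (compile C) (start (compile C) , ts) time (final , ts′)
    exit≡   : exit (compile C) final ≡ s

weaken : ∀ {C : Code e} {ts t t′ s ts′} → t ≤ t′ → Runs C ts t s ts′ → Runs C ts t′ s ts′
weaken le (runs u r x) = runs (≤-trans u le) r x

ret-runs : ∀ {s} {ts : Tapes e} → Runs (ret s) ts 0 s ts
ret-runs {s = s} = runs z≤n (halt-at (compile (ret s)) refl) refl

prim-runs : (g : Vec Symbol (suc e) → Symbol × Action e) (ts : Tapes e) →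
            let (s , a) = g (Vec.map head ts) in Runs (prim g) ts 1 s (zipWith act a ts)
prim-runs g ts = runs ≤-refl (next-at (compile (prim g)) refl (halt-at (compile (prim g)) refl)) refl

bind-runs : {C : Code e} {K : Symbol → Code e} → ∀ {ts t s ts′ u r ts″} →
            Runs C ts t s ts′ → Runs (K s) ts′ u r ts″ → Runs (bind C K) ts (t + suc u) r ts″
bind-runs {C = C} {K} (runs t≤ f refl) (runs u≤ k refl) =
  runs (+-mono-≤ t≤ (s≤s u≤))
       (bind-inj₁ (compile C) (compile ∘ K) f (bind-inj₂ (compile C) (compile ∘ K) k)) refl

-- Two verdicts leave a loop, so that a loop can report how it ended: carry absorbed or overflow,
-- strings equal or different, search exhausted or successful.
data Leaves : Symbol → Set where
  done   : Leaves nothing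
  failed : Leaves (just false)

loop-stop : {C : Code e} → ∀ {ts t s ts′} → Leaves s → Runs C ts t s ts′ → Runs (loop C) ts t s ts′
loop-stop {C = C} {ts′ = ts′} l (runs {t} {q} t≤ r refl) =
  runs (≤-trans (≤-reflexive (+-identityʳ t)) t≤)
       (loop-lift F r λ eq → halt-at (loopFrag F) (stop eq l refl)) refl
  where
  F = compile C
  stop : ∀ {s} → δ F q (Vec.map head ts′) ≡ nothing → Leaves s → exit F q ≡ s →
         loopδ F q (Vec.map head ts′) ≡ nothing
  stop eq done   x rewrite eq | x = refl
  stop eq failed x rewrite eq | x = refl

loop-next : {C : Code e} → ∀ {ts t ts′ u s ts″} → Runs C ts t (just true) ts′ →
            Runs (loop C) ts′ u s ts″ → Runs (loop C) ts (t + suc u) s ts″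
loop-next {C = C} {ts′ = ts′} {ts″ = ts″} (runs {_} {q} t≤ r x) (runs {u} {qf} u≤ r′ y) =
  runs (+-mono-≤ t≤ (s≤s u≤)) (loop-lift F r λ eq → next-at (loopFrag F) (loopδ-again F eq x) back) y
  where
  F = compile C
  back : _⟶[_]_ (loopFrag F) (start F , zipWith act (keep (Vec.map head ts′)) ts′) u (qf , ts″)
  back = subst (λ ts → _⟶[_]_ (loopFrag F) (start F , ts) u (qf , ts″)) (sym (keep-act ts′)) r′

-- Stack programs

-- A tape that holds an input with the head on its first bit is a stack: pop writes a blank and moves
-- right, push moves left and writes.  Stack 0 serves as input, query and output, stack 2 keeps the
-- string x reversed, stack 3 holds a counter or a candidate, and stacks 1 and 4 are scratch.  The
-- e further tapes are used only while a given machine runs, and are blank otherwise.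
Stacks : Set
Stacks = Vec String 5

tapesOf : Stacks → Tapes (4 + e)
tapesOf {e} σ = Vec.map inputTape σ Vec.++ replicate e blankTape

record Exec (C : Code (4 + e)) (σ : Stacks) (t : ℕ) (s : Symbol) (σ′ : Stacks) : Set where
  constructor exec
  field runsOf : Runs C (tapesOf σ) t s (tapesOf σ′)

module _ {C : Code (4 + e)} where

  weaken-exec : ∀ {σ t t′ s σ′} → t ≤ t′ → Exec C σ t s σ′ → Exec C σ t′ s σ′
  weaken-exec le (exec r) = exec (weaken le r)

  lasting : ∀ {σ t t′ s σ′} → t ≡ t′ → Exec C σ t s σ′ → Exec C σ t′ s σ′
  lasting refl r = r

  exiting : ∀ {σ t s s′ σ′} → s ≡ s′ → Exec C σ t s σ′ → Exec C σ t s′ σ′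
  exiting refl r = r

  ending : ∀ {A : Set} {a a′ : A} {σ t s} (P : A → Stacks) → a ≡ a′ →
           Exec C σ t s (P a) → Exec C σ t s (P a′)
  ending P refl r = r

  bind-exec : ∀ {K : Symbol → Code (4 + e)} {σ t s σ′ u r σ″} →
              Exec C σ t s σ′ → Exec (K s) σ′ u r σ″ → Exec (bind C K) σ (t + suc u) r σ″
  bind-exec (exec r) (exec k) = exec (bind-runs r k)

  stop-exec : ∀ {σ t s σ′} → Leaves s → Exec C σ t s σ′ → Exec (loop C) σ t s σ′
  stop-exec l (exec r) = exec (loop-stop l r)

  next-exec : ∀ {σ t σ′ u s σ″} → Exec C σ t (just true) σ′ → Exec (loop C) σ′ u s σ″ →
              Exec (loop C) σ (t + suc u) s σ″
  next-exec (exec r) (exec k) = exec (loop-next r k)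

ret-exec : ∀ {s σ} → Exec {e} (ret s) σ 0 s σ
ret-exec = exec ret-runs

act-at : ∀ {n} (j : Fin n) a (ts : Vec Tape n) →
         zipWith act (keep (Vec.map head ts) [ j ]≔ a) ts ≡ ts [ j ]≔ act a (lookup ts j)
act-at zero    a (t ∷ ts) = cong (act a t ∷_) (keep-act ts)
act-at (suc j) a (t ∷ ts) = cong (t ∷_) (act-at j a ts)

lookup-tapesOf : ∀ (i : Fin 5) σ → lookup (tapesOf {e} σ) (i ↑ˡ e) ≡ inputTape (lookup σ i)
lookup-tapesOf i σ = trans (lookup-++ˡ (Vec.map inputTape σ) _ i) (lookup-map i inputTape σ)

update-tapesOf : ∀ (i : Fin 5) σ x → tapesOf {e} σ [ i ↑ˡ e ]≔ inputTape x ≡ tapesOf (σ [ i ]≔ x)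
update-tapesOf {e} i σ x =
  trans ([]≔-++-↑ˡ (Vec.map inputTape σ) (replicate e blankTape) i)
        (cong (Vec._++ replicate e blankTape) (sym (map-[]≔ inputTape σ i)))

peek : Fin 5 → (Symbol → Symbol × Move) → Vec Symbol (5 + e) → Symbol × Action (4 + e)
peek {e} i g hs = lookup hs (i ↑ˡ e) , keep hs [ i ↑ˡ e ]≔ g (lookup hs (i ↑ˡ e))

stepAt : Fin 5 → (Symbol → Symbol × Move) → Code (4 + e)
stepAt i g = prim (peek i g)

stepAt-runs : ∀ (i : Fin 5) g {ts : Tapes (4 + e)} {t} → lookup ts (i ↑ˡ e) ≡ t →
              Runs (stepAt i g) ts 1 (head t) (ts [ i ↑ˡ e ]≔ act (g (head t)) t)
stepAt-runs {e} i g {ts} refl =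
  subst₂ (Runs (stepAt i g) ts 1) h≡ acted (prim-runs (peek i g) ts)
  where
  h≡ : lookup (Vec.map head ts) (i ↑ˡ e) ≡ head (lookup ts (i ↑ˡ e))
  h≡ = lookup-map (i ↑ˡ e) head ts
  acted : zipWith act (proj₂ (peek i g (Vec.map head ts))) ts ≡
          ts [ i ↑ˡ e ]≔ act (g (head (lookup ts (i ↑ˡ e)))) (lookup ts (i ↑ˡ e))
  acted = trans (act-at (i ↑ˡ e) (g (lookup (Vec.map head ts) (i ↑ˡ e))) ts)
                (cong (λ h → ts [ i ↑ˡ e ]≔ act (g h) (lookup ts (i ↑ˡ e))) h≡)

pop : Fin 5 → Code (4 + e)
pop i = stepAt i (const (nothing , right))

-- Since `◂` stores no blanks at the far end, the erased cell leaves no trace to the left of the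
-- head. The result is literally an `inputTape` again, also when the stack was empty.
pop-exec : ∀ (i : Fin 5) σ →
           Exec {e} (pop i) σ 1 (List.head (lookup σ i)) (σ [ i ]≔ List.drop 1 (lookup σ i))
pop-exec {e} i σ =
  exec (subst (Runs (pop i) (tapesOf σ) 1 _) (update-tapesOf i σ _) (popped (lookup σ i) (lookup-tapesOf i σ)))
  where
  popped : ∀ x → lookup (tapesOf {e} σ) (i ↑ˡ e) ≡ inputTape x →
           Runs (pop i) (tapesOf σ) 1 (List.head x) (tapesOf σ [ i ↑ˡ e ]≔ inputTape (List.drop 1 x))
  popped []          = stepAt-runs i _
  popped (_ ∷ [])    = stepAt-runs i _
  popped (_ ∷ _ ∷ _) = stepAt-runs i _

push : Fin 5 → Bool → Code (4 + e)
push i b = bind (stepAt i (_, left)) λ _ → stepAt i (const (just b , stay))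

push-exec : ∀ (i : Fin 5) b σ → Exec {e} (push i b) σ 3 nothing (σ [ i ]≔ (b ∷ lookup σ i))
push-exec {e} i b σ =
  exec (subst (Runs (push i b) (tapesOf σ) 3 nothing) (update-tapesOf i σ _) (pushed (lookup σ i) (lookup-tapesOf i σ)))
  where
  ts = tapesOf {e} σ
  j = i ↑ˡ e
  twice : ∀ {t u} → lookup ts j ≡ t → u ≡ act (head t , left) t → head u ≡ nothing →
          Runs (push i b) ts 3 nothing (ts [ j ]≔ act (just b , stay) u)
  twice {t} {u} t≡ refl u≡ =
    subst₂ (Runs (push i b) ts 3) u≡ ([]≔-idempotent ts j)
      (bind-runs (stepAt-runs i (_, left) t≡) (stepAt-runs i (const (just b , stay)) (lookup∘update j ts u)))
  pushed : ∀ x → lookup ts j ≡ inputTape x → Runs (push i b) ts 3 nothing (ts [ j ]≔ inputTape (b ∷ x))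
  pushed []      t≡ = twice t≡ refl refl
  pushed (_ ∷ _) t≡ = twice t≡ refl refl

-- Running a given machine as a subroutine

Decides : Frag e → (ℕ → ℕ) → (String → Bool) → Set
Decides {e} F T b = ∀ x → ∃[ ts ] Runs (frag F) (inputTape x ∷ replicate e blankTape) (T (length x)) (just (b x)) ts

module _ (F : Frag e) where

  idle : ∀ {n} {A : Set} → Symbol → Maybe (A × Vec (Symbol × Move) (suc n)) →
         Maybe (A × Vec (Symbol × Move) (suc (suc n)))
  idle s = Maybe.map λ { (q , a ∷ as) → q , a ∷ (s , stay) ∷ as }

  -- The machines for `Pos` and `Neg` may differ in their number of tapes, while the code that calls
  -- both has one fixed number. Idle blank tapes make up the difference.
  pad : Frag (suc e)
  pad = record
    { State = State F ; finite = finite F ; start = start F ; exit = exit F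
    ; δ = λ { q (h ∷ s ∷ hs) → idle s (δ F q (h ∷ hs)) } }

  pad-run : ∀ {q t ts n q′ t′ ts′} → _⟶[_]_ F (q , t ∷ ts) n (q′ , t′ ∷ ts′) →
            _⟶[_]_ pad (q , t ∷ blankTape ∷ ts) n (q′ , t′ ∷ blankTape ∷ ts′)
  pad-run r with view F r
  ... | stops eq                 = halt-at pad (cong (idle nothing) eq)
  ... | moves {a = _ ∷ _} eq r′ = next-at pad (cong (idle nothing) eq) (pad-run r′)

  pad-decides : ∀ {T b} → Decides F T b → Decides pad T b
  pad-decides D x with D x
  ... | _ ∷ _ , runs t≤ r x≡ = _ , runs t≤ (pad-run r) x≡

padBy : ∀ {e T b} d → Σ[ F ∈ Frag e ] Decides F T b → Σ[ F ∈ Frag (d + e) ] Decides F T b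
padBy zero FD = FD
padBy {T = T} {b} (suc d) FD = let (F , D) = padBy {T = T} {b} d FD in pad F , pad-decides F {T} {b} D

zipWith-act : ∀ {n} (f : Symbol → Symbol × Move) (ts : Vec Tape n) →
              zipWith act (Vec.map f (Vec.map head ts)) ts ≡ Vec.map (λ t → act (f (head t)) t) ts
zipWith-act f []       = refl
zipWith-act f (t ∷ ts) = cong (_ ∷_) (zipWith-act f ts)

-- Only stored cells are counted: at most a to the left of the head and b to its right.
Extent : ℕ → ℕ → Tape → Set
Extent a b t = length (before t) ≤ a × length (after t) ≤ b

◂-length : ∀ s ss → length (s ◂ ss) ≤ suc (length ss)
◂-length nothing  []      = z≤n
◂-length nothing  (_ ∷ _) = ≤-refl
◂-length (just _) _       = ≤-refl

goRight wipeLeft : Symbol → Symbol × Move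
goRight = _, right
wipeLeft _ = nothing , left

goRight-extent : ∀ {a b t} → Extent a (suc b) t → Extent (suc a) b (act (goRight (head t)) t)
goRight-extent {t = tape ls h []}      (l , r) = ≤-trans (◂-length h ls) (s≤s l) , z≤n
goRight-extent {t = tape ls h (_ ∷ _)} (l , r) = ≤-trans (◂-length h ls) (s≤s l) , s≤s⁻¹ r

wipeLeft-extent : ∀ {a t} → Extent (suc a) 0 t → Extent a 0 (act (wipeLeft (head t)) t)
wipeLeft-extent {t = tape []      _ []} (l , r) = z≤n , z≤n
wipeLeft-extent {t = tape (_ ∷ _) _ []} (l , r) = s≤s⁻¹ l , z≤n

wipe-extent : ∀ {t} → Extent 0 0 t → act (nothing , stay) t ≡ blankTape
wipe-extent {tape [] _ []} _ = refl

act-extent : ∀ m {n t} → Extent n n t → Extent (suc n) (suc n) (act m t)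
act-extent (s , left)  {t = tape []       _ rs}       (l , r) = z≤n , ≤-trans (◂-length s rs) (s≤s r)
act-extent (s , left)  {t = tape (_ ∷ _)  _ rs}       (l , r) = m≤n⇒m≤1+n (m<1+n⇒m≤n (m≤n⇒m≤1+n l)) , ≤-trans (◂-length s rs) (s≤s r)
act-extent (s , stay)                                 (l , r) = m≤n⇒m≤1+n l , m≤n⇒m≤1+n r
act-extent (s , right) {t = tape ls       _ []}       (l , r) = ≤-trans (◂-length s ls) (s≤s l) , z≤n
act-extent (s , right) {t = tape ls       _ (_ ∷ _)}  (l , r) = ≤-trans (◂-length s ls) (s≤s l) , m≤n⇒m≤1+n (<⇒≤ r)

run-extent : (F : Frag e) → ∀ {q ts t q′ ts′ n} → _⟶[_]_ F (q , ts) t (q′ , ts′) →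
             All (Extent n n) ts → All (Extent (t + n) (t + n)) ts′
run-extent F r E with view F r
... | stops _ = E
run-extent F {ts′ = ts′} {n} _ E | moves {a = as} {t} _ r =
  subst (λ k → All (Extent k k) ts′) (+-suc t n) (run-extent F r (step as E))
  where
  step : ∀ {m ts} (as : Vec (Symbol × Move) m) → All (Extent n n) ts → All (Extent (suc n) (suc n)) (zipWith act as ts)
  step []       []       = []
  step (a ∷ as) (E ∷ Es) = act-extent a E ∷ step as Es

-- A clock is a run of j + k marks: j of them are already behind the moving head, which next enters
-- the remaining k (aheadClock), or it has k marks behind it and j left to visit (behindClock).
aheadClock : ℕ → ℕ → Tape
aheadClock j zero    = tape (List.replicate j (just true)) nothing []
aheadClock j (suc k) = tape (List.replicate j (just true)) (just true) (List.replicate k (just true))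

behindClock : ℕ → ℕ → Tape
behindClock zero    k = tape [] nothing (List.replicate k (just true))
behindClock (suc j) k = tape (List.replicate j (just true)) (just true) (List.replicate k (just true))

aheadClock-input : ∀ k → inputTape (List.replicate k true) ≡ aheadClock 0 k
aheadClock-input zero    = refl
aheadClock-input (suc k) = cong (tape [] (just true)) (map-replicate just k true)

module _ (M : Frag e) where

  withClock : ∀ {A : Set} (x y i : Symbol) → Maybe (A × Action e) → Maybe (A × Action (4 + e))
  withClock x y i = Maybe.map λ { (q , a ∷ as) →
    q , a ∷ (just true , left) ∷ (x , stay) ∷ (y , stay) ∷ (i , stay) ∷ as }

  -- Each simulated step adds a mark at the left end of the clock. The clock starts with one mark
  -- per bit of the query, so its marks bound the extent of every tape of `M`, the input tape
  -- included.
  timed : Frag (4 + e)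
  timed = record
    { State = State M ; finite = finite M ; start = start M ; exit = exit M
    ; δ = λ { q (h ∷ _ ∷ x ∷ y ∷ i ∷ hs) → withClock x y i (δ M q (h ∷ hs)) } }

  timed-run : ∀ {q t ts n q′ t′ ts′} k {x y i} → _⟶[_]_ M (q , t ∷ ts) n (q′ , t′ ∷ ts′) →
              _⟶[_]_ timed (q , t ∷ behindClock 0 k ∷ x ∷ y ∷ i ∷ ts) n
                           (q′ , t′ ∷ behindClock 0 (n + k) ∷ x ∷ y ∷ i ∷ ts′)
  timed-run k r with view M r
  ... | stops eq = halt-at timed (cong (withClock _ _ _) eq)
  timed-run {t = t} {ts} {q′ = q′} {t′} {ts′} k {x} {y} {i} _ | moves {q₁} {a ∷ as} {n} eq r =
    next-at timed (cong (withClock _ _ _) eq)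
      (subst (λ m → _⟶[_]_ timed (q₁ , act a t ∷ behindClock 0 (suc k) ∷ x ∷ y ∷ i ∷ zipWith act as ts) n
                                 (q′ , t′ ∷ behindClock 0 m ∷ x ∷ y ∷ i ∷ ts′))
             (+-suc n k) (timed-run (suc k) r))

module _ (f g f′ g′ : Symbol → Symbol × Move) where

  -- Nothing on the tapes of the called machine can serve as an end marker, so the clock is the loop
  -- condition: a mark asks for one more move, and the blank after the last mark triggers the
  -- closing action.
  sweepStep : Vec Symbol (suc (4 + e)) → Symbol × Action (4 + e)
  sweepStep (h ∷ just c  ∷ x ∷ y ∷ i ∷ hs) =
    just true , f h ∷ g (just c) ∷ (x , stay) ∷ (y , stay) ∷ (i , stay) ∷ Vec.map f hs
  sweepStep (h ∷ nothing ∷ x ∷ y ∷ i ∷ hs) =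
    nothing , f′ h ∷ g′ nothing ∷ (x , stay) ∷ (y , stay) ∷ (i , stay) ∷ Vec.map f′ hs

  sweep : Code (4 + e)
  sweep = loop (prim sweepStep)

  -- The clock runs through C 0 k, C 1 (k - 1), …, C k 0 while f is applied to the other tapes.
  sweep-runs : (C : ℕ → ℕ → Tape) (P : ℕ → ℕ → Tape → Set) →
    (∀ j k → act (g (just true)) (C j (suc k)) ≡ C (suc j) k) →
    (∀ j k → head (C j (suc k)) ≡ just true) → (∀ j → head (C j 0) ≡ nothing) →
    (∀ j k {t} → P j (suc k) t → P (suc j) k (act (f (head t)) t)) →
    ∀ k j {t x y i} {ts : Vec Tape e} → All (P j k) (t ∷ ts) →
    ∃[ u ] ∃[ us ] (All (P (k + j) 0) (u ∷ us) ×
      Runs sweep (t ∷ C j k ∷ x ∷ y ∷ i ∷ ts) (k * 2 + 1) nothing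
        (act (f′ (head u)) u ∷ act (g′ nothing) (C (k + j) 0) ∷ x ∷ y ∷ i ∷
         Vec.map (λ u → act (f′ (head u)) u) us))
  sweep-runs C P C-step C-on C-off P-step zero j {t} {x} {y} {i} {ts} Ps =
    t , ts , Ps , loop-stop done (move-one (head (C j 0)) (C-off j) refl)
    where
    ts₀ = t ∷ C j 0 ∷ x ∷ y ∷ i ∷ ts
    ts₁ = act (f′ (head t)) t ∷ act (g′ nothing) (C j 0) ∷ x ∷ y ∷ i ∷ Vec.map (λ u → act (f′ (head u)) u) ts
    move-one : ∀ h → h ≡ nothing → head (C j 0) ≡ h → Runs (prim sweepStep) ts₀ 1 nothing ts₁
    move-one _ refl h≡ = subst₂ (Runs (prim sweepStep) ts₀ 1) (cong proj₁ stepped)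
      (trans (cong (λ s → zipWith act (proj₂ s) ts₀) stepped) (cong (λ us → _ ∷ _ ∷ x ∷ y ∷ i ∷ us) (zipWith-act f′ ts)))
      (prim-runs sweepStep ts₀)
      where
      stepped : sweepStep (Vec.map head ts₀) ≡
                sweepStep (head t ∷ nothing ∷ head x ∷ head y ∷ head i ∷ Vec.map head ts)
      stepped = cong (λ c → sweepStep (head t ∷ c ∷ head x ∷ head y ∷ head i ∷ Vec.map head ts)) h≡
  sweep-runs {e} C P C-step C-on C-off P-step (suc k) j {t} {x} {y} {i} {ts} (p ∷ ps) =
    let u , us , P0 , rest = sweep-runs C P C-step C-on C-off P-step k (suc j) {x = x} {y} {i} (P-step j k p ∷ stepAll ps)
    in u , us , subst (λ m → All (P m 0) (u ∷ us)) (+-suc k j) P0 ,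
       loop-next first (subst (λ m → Runs sweep (ts₁ (C (suc j) k)) (k * 2 + 1) nothing (end m u us)) (+-suc k j) rest)
    where
    ts₀ : Tapes (4 + e)
    ts₀ = t ∷ C j (suc k) ∷ x ∷ y ∷ i ∷ ts
    ts₁ : Tape → Tapes (4 + e)
    ts₁ c = act (f (head t)) t ∷ c ∷ x ∷ y ∷ i ∷ Vec.map (λ u → act (f (head u)) u) ts
    end : ℕ → Tape → Vec Tape e → Tapes (4 + e)
    end m u us = act (f′ (head u)) u ∷ act (g′ nothing) (C m 0) ∷ x ∷ y ∷ i ∷ Vec.map (λ u → act (f′ (head u)) u) us
    stepAll : ∀ {n} {ts : Vec Tape n} → All (P j (suc k)) ts → All (P (suc j) k) (Vec.map (λ t → act (f (head t)) t) ts)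
    stepAll []       = []
    stepAll (p ∷ ps) = P-step j k p ∷ stepAll ps
    stepped : sweepStep (Vec.map head ts₀) ≡
              sweepStep (head t ∷ just true ∷ head x ∷ head y ∷ head i ∷ Vec.map head ts)
    stepped = cong (λ c → sweepStep (head t ∷ c ∷ head x ∷ head y ∷ head i ∷ Vec.map head ts)) (C-on j k)
    first : Runs (prim sweepStep) ts₀ 1 (just true) (ts₁ (C (suc j) k))
    first = subst₂ (Runs (prim sweepStep) ts₀ 1) (cong proj₁ stepped)
      (trans (cong (λ s → zipWith act (proj₂ s) ts₀) stepped)
             (cong₂ (λ c us → _ ∷ c ∷ x ∷ y ∷ i ∷ us) (C-step j k) (zipWith-act f ts)))
      (prim-runs sweepStep ts₀)

  sweep-all : (C : ℕ → ℕ → Tape) (P : ℕ → ℕ → Tape → Set) →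
    (∀ j k → act (g (just true)) (C j (suc k)) ≡ C (suc j) k) →
    (∀ j k → head (C j (suc k)) ≡ just true) → (∀ j → head (C j 0) ≡ nothing) →
    (∀ j k {t} → P j (suc k) t → P (suc j) k (act (f (head t)) t)) →
    ∀ k {t x y i} {ts : Vec Tape e} → All (P 0 k) (t ∷ ts) →
    ∃[ u ] ∃[ us ] (All (P k 0) (u ∷ us) ×
      (∀ {c c′} → C 0 k ≡ c → act (g′ nothing) (C k 0) ≡ c′ →
       Runs sweep (t ∷ c ∷ x ∷ y ∷ i ∷ ts) (k * 2 + 1) nothing
         (act (f′ (head u)) u ∷ c′ ∷ x ∷ y ∷ i ∷ Vec.map (λ u → act (f′ (head u)) u) us)))
  sweep-all C P C-step C-on C-off P-step k {t} {x} {y} {i} {ts} Ps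
    with sweep-runs C P C-step C-on C-off P-step k 0 {t} {x} {y} {i} {ts} Ps
  ... | result rewrite +-identityʳ k =
    let u , us , P0 , r = result in u , us , P0 , λ { refl refl → r }

-- A machine that ran for k steps has touched only cells within distance k.  So moving k cells to
-- the right and then erasing 2k cells to the left blanks its tapes, wherever their heads are.
clean : Code (4 + e)
clean = bind (stepAt (suc zero) (_, right)) λ _ →
        bind (sweep goRight (_, right) (_, stay) (_, left)) λ _ →
        bind (sweep wipeLeft (_, left) (_, stay) (_, right)) λ _ →
        -- This pass also uses up the marks of the clock. Its closing action blanks the cell under
        -- each head, the only one that can be left after 2k erasing moves.
        sweep wipeLeft (const (nothing , right)) (const (nothing , stay)) (_, stay)

clean-runs : ∀ k {t x y i} {ts : Vec Tape e} → All (Extent k k) (t ∷ ts) →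
             Runs clean (t ∷ behindClock 0 k ∷ x ∷ y ∷ i ∷ ts) (k * 6 + 7) nothing
                        (blankTape ∷ blankTape ∷ x ∷ y ∷ i ∷ replicate e blankTape)
clean-runs {e} k {t} {x} {y} {i} {ts} E =
  let u₁ , us₁ , E₁ , r₁ = sweep-all goRight (_, right) (_, stay) (_, left) aheadClock (λ j → Extent (j + k))
                             ahead-step (λ _ _ → refl) (λ _ → refl) (λ _ _ {t} → goRight-extent {t = t}) k {x = x} {y} {i} E
      u₂ , us₂ , E₂ , r₂ = sweep-all wipeLeft (_, left) (_, stay) (_, right) behind (λ _ m → Extent (m + k) 0)
                             behind-step (λ _ _ → refl) (λ _ → refl) (λ _ _ {t} → wipeLeft-extent {t = t}) k
                             {x = x} {y} {i} (stayAll E₁)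
      u₃ , us₃ , E₃ , r₃ = sweep-all wipeLeft (const (nothing , right)) (const (nothing , stay)) (_, stay)
                             (λ _ → aheadClock 0) (λ _ m → Extent m 0)
                             wipe-step (λ _ _ → refl) (λ _ → refl) (λ _ _ {t} → wipeLeft-extent {t = t}) k
                             {x = x} {y} {i} (stayAll E₂)
  in weaken (≤-reflexive (time≡ k))
     (bind-runs (stepAt-runs (suc zero) (_, right) refl)
     (bind-runs (r₁ (sym (enter k)) refl)
     (bind-runs (r₂ (sym (turn k)) refl)
     (subst (Runs _ _ (k * 2 + 1) nothing) (wiped E₃) (r₃ (sym (enter k)) refl)))))
  where
  behind : ℕ → ℕ → Tape
  behind j m = behindClock m j
  ahead-step : ∀ j m → act (just true , right) (aheadClock j (suc m)) ≡ aheadClock (suc j) m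
  ahead-step j zero    = refl
  ahead-step j (suc m) = refl
  behind-step : ∀ j m → act (just true , left) (behind j (suc m)) ≡ behind (suc j) m
  behind-step j zero    = refl
  behind-step j (suc m) = refl
  wipe-step : ∀ j m → act (nothing , right) (aheadClock 0 (suc m)) ≡ aheadClock 0 m
  wipe-step j zero    = refl
  wipe-step j (suc m) = refl
  stayAll : ∀ {n} {P : Tape → Set} {ts : Vec Tape n} → All P ts → All P (Vec.map (λ t → act (head t , stay) t) ts)
  stayAll []       = []
  stayAll (p ∷ ps) = p ∷ stayAll ps
  enter : ∀ k → act (nothing , right) (behindClock 0 k) ≡ aheadClock 0 k
  enter zero    = refl
  enter (suc k) = refl
  turn : ∀ k → act (nothing , left) (aheadClock k 0) ≡ behindClock k 0
  turn zero    = refl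
  turn (suc k) = refl
  wipeAll : ∀ {n} {ts : Vec Tape n} → All (Extent 0 0) ts →
            Vec.map (act (nothing , stay)) ts ≡ replicate n blankTape
  wipeAll []       = refl
  wipeAll {ts = t ∷ _} (E ∷ Es) = cong₂ _∷_ (wipe-extent {t} E) (wipeAll Es)
  wiped : ∀ {u us} → All (Extent 0 0) (u ∷ us) →
          act (nothing , stay) u ∷ blankTape ∷ x ∷ y ∷ i ∷ Vec.map (act (nothing , stay)) us ≡
          blankTape ∷ blankTape ∷ x ∷ y ∷ i ∷ replicate e blankTape
  wiped {u} (E ∷ Es) = cong₂ (λ u us → u ∷ blankTape ∷ x ∷ y ∷ i ∷ us) (wipe-extent {u} E) (wipeAll Es)
  time≡ : ∀ k → 1 + suc (k * 2 + 1 + suc (k * 2 + 1 + suc (k * 2 + 1))) ≡ k * 6 + 7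
  time≡ = solve-∀

call : Frag e → Code (4 + e)
call M = bind (stepAt (suc zero) (_, left)) λ _ → bind (frag (timed M)) λ s → bind clean λ _ → ret s

call-exec : ∀ {M : Frag e} T {b} → Decides M T b → ∀ q x y i →
            Exec (call M) (q ∷ List.replicate (length q) true ∷ x ∷ y ∷ i ∷ [])
                 (T (length q) * 7 + length q * 6 + 11) (just (b q)) ([] ∷ [] ∷ x ∷ y ∷ i ∷ [])
call-exec {e} {M} T D q x y i with D q
... | t ∷ ts , runs {u} {qf} u≤ r s≡ =
  exec (weaken time≤
    (bind-runs (stepAt-runs (suc zero) (_, left) (aheadClock-input n))
    (bind-runs {C = frag (timed M)} (runs ≤-refl (subst starting (sym (enter n)) (timed-run M n r)) s≡)
    -- `M` made `u` steps from tapes of extent at most `n`, and the clock shows exactly `u + n`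
    -- marks.
    (bind-runs (clean-runs (u + n) (run-extent M r (input-extent q ∷ blanks e)))
    ret-runs))))
  where
  n = length q
  starting : Tape → Set
  starting c = _⟶[_]_ (timed M) (start M , inputTape q ∷ c ∷ inputTape x ∷ inputTape y ∷ inputTape i ∷ replicate e blankTape)
                 u (qf , t ∷ behindClock 0 (u + n) ∷ inputTape x ∷ inputTape y ∷ inputTape i ∷ ts)
  enter : ∀ n → act (head (aheadClock 0 n) , left) (aheadClock 0 n) ≡ behindClock 0 n
  enter zero    = refl
  enter (suc n) = refl
  input-extent : ∀ x → Extent (length x) (length x) (inputTape x)
  input-extent []      = z≤n , z≤n
  input-extent (_ ∷ x) = z≤n , ≤-trans (≤-reflexive (length-map just x)) (n≤1+n _)
  blanks : ∀ m → All (Extent n n) (replicate m blankTape)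
  blanks zero    = []
  blanks (suc m) = (z≤n , z≤n) ∷ blanks m
  time≡ : ∀ u n → 1 + suc (u + suc ((u + n) * 6 + 7 + 1)) ≡ u * 7 + n * 6 + 11
  time≡ = solve-∀
  time≤ : 1 + suc (u + suc ((u + n) * 6 + 7 + 1)) ≤ T n * 7 + n * 6 + 11
  time≤ = ≤-trans (≤-reflexive (time≡ u n)) (+-monoˡ-≤ 11 (+-monoˡ-≤ (n * 6) (*-monoˡ-≤ 7 u≤)))

-- Loops over a stack, binary counters, comparison

infixr 4 _⨾_
_⨾_ : Code e → Code e → Code e
C ⨾ D = bind C λ _ → D

eachStep : (Bool → Code e) → Symbol → Code e
eachStep body nothing  = ret nothing
eachStep body (just b) = body b ⨾ ret (just true)

forEach : Fin 5 → (Bool → Code (4 + e)) → Code (4 + e)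
forEach i body = loop (bind (pop i) (eachStep body))

-- P rest done describes the stacks when rest is still to be processed and done, most recent bit first,
-- has been.
forEach-exec : ∀ (i : Fin 5) {body : Bool → Code (4 + e)} (P : String → String → Stacks) (B n : ℕ) →
  (∀ r p → lookup (P r p) i ≡ r) → (∀ q r p → P q p [ i ]≔ r ≡ P r p) →
  (∀ b r p → length r + length p < n → Exec (body b) (P r p) B nothing (P r (b ∷ p))) →
  ∀ x → length x ≤ n → Exec (forEach i body) (P x []) (n * (B + 4) + 2) nothing (P [] (reverse x))
forEach-exec {e} i {body} P B n at upd step x x≤ =
  weaken-exec (+-monoˡ-≤ 2 (*-monoˡ-≤ (B + 4) x≤)) (go x [] (≤-trans (≤-reflexive (+-identityʳ (length x))) x≤))
  where
  popped : ∀ x p → Exec {e} (pop i) (P x p) 1 (List.head x) (P (List.drop 1 x) p)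
  popped x p = subst₂ (λ y σ → Exec (pop i) (P x p) 1 (List.head y) σ) (at x p)
                 (trans (cong (λ y → P x p [ i ]≔ List.drop 1 y) (at x p)) (upd x (List.drop 1 x) p))
                 (pop-exec i (P x p))
  time≡ : ∀ B m → 1 + suc (B + 1) + suc (m * (B + 4) + 2) ≡ suc m * (B + 4) + 2
  time≡ = solve-∀
  go : ∀ x p → length x + length p ≤ n →
       Exec (forEach i body) (P x p) (length x * (B + 4) + 2) nothing (P [] (x ʳ++ p))
  go []      p le = stop-exec done (bind-exec (popped [] p) ret-exec)
  go (b ∷ x) p le = weaken-exec (≤-reflexive (time≡ B (length x)))
    (next-exec (bind-exec (popped (b ∷ x) p) (bind-exec (step b x p le) ret-exec))
               (go x (b ∷ p) (≤-trans (≤-reflexive (+-suc (length x) (length p))) le)))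

parseStep : Symbol → Symbol → Code (4 + e)
parseStep (just true)  (just true)  = push 4F true ⨾ ret (just true)
parseStep (just false) (just false) = push 4F false ⨾ ret (just true)
parseStep _            _            = ret nothing

parse : Code (4 + e)
parse = loop (bind (pop 0F) λ s → bind (pop 0F) (parseStep s))

parse-exec : ∀ u {x p} → Exec {e} parse (pair u x ∷ [] ∷ [] ∷ [] ∷ p ∷ []) (length u * 9 + 4) nothing
                                        (x ∷ [] ∷ [] ∷ [] ∷ (u ʳ++ p) ∷ [])
parse-exec []          = stop-exec done (bind-exec (pop-exec 0F _) (bind-exec (pop-exec 0F _) ret-exec))
parse-exec (true ∷ u)  = next-exec
  (bind-exec (pop-exec 0F _) (bind-exec (pop-exec 0F _) (bind-exec (push-exec 4F true _) ret-exec))) (parse-exec u)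
parse-exec (false ∷ u) = next-exec
  (bind-exec (pop-exec 0F _) (bind-exec (pop-exec 0F _) (bind-exec (push-exec 4F false _) ret-exec))) (parse-exec u)

-- Binary increment, least significant bit first; since bijective base 2 uses the same carry, it also
-- drives the counter in count, where an overflow appends a digit.
bump : String → String
bump []          = []
bump (true ∷ y)  = false ∷ bump y
bump (false ∷ y) = true ∷ y

overflow : String → Symbol
overflow []          = just false
overflow (true ∷ y)  = overflow y
overflow (false ∷ y) = nothing

bump-length : ∀ y → length (bump y) ≡ length y
bump-length []          = refl
bump-length (true ∷ y)  = cong suc (bump-length y)
bump-length (false ∷ y) = refl

incStep : Symbol → Code (4 + e)
incStep nothing      = ret (just false)
incStep (just true)  = push 1F false ⨾ ret (just true)
incStep (just false) = push 3F true ⨾ ret nothing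

incLoop inc : Code (4 + e)
incLoop = loop (bind (pop 3F) incStep)
inc = bind incLoop λ s → forEach 1F (push 3F) ⨾ ret s

incTime : ℕ → ℕ
incTime n = n * 7 + 6 + suc (n * 7 + 2 + 1)

-- Where the carry stops is not known in advance, so the split into flipped digits (stack 1) and
-- untouched ones (stack 3) is existential. The equation says that pouring stack 1 back yields the
-- incremented string.
incLoop-exec : ∀ {q x i} y z → ∃[ y′ ] ∃[ z′ ] length z′ ≤ length y + length z × z′ ʳ++ y′ ≡ z ʳ++ bump y ×
  Exec {e} incLoop (q ∷ z ∷ x ∷ y ∷ i ∷ []) (length y * 7 + 6) (overflow y) (q ∷ z′ ∷ x ∷ y′ ∷ i ∷ [])
incLoop-exec []          z = [] , z , ≤-refl , refl , stop-exec failed (weaken-exec (s≤s (s≤s z≤n)) (bind-exec (pop-exec 3F _) ret-exec))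
incLoop-exec (false ∷ y) z = true ∷ y , z , m≤n+m _ _ , refl ,
  stop-exec done (weaken-exec (m≤n+m 6 (length (false ∷ y) * 7)) (bind-exec (pop-exec 3F _) (bind-exec (push-exec 3F true _) ret-exec)))
incLoop-exec (true ∷ y) z =
  let y′ , z′ , len , eq , r = incLoop-exec y (false ∷ z)
  in y′ , z′ , ≤-trans len (≤-reflexive (+-suc (length y) (length z))) , eq ,
     next-exec (bind-exec (pop-exec 3F _) (bind-exec (push-exec 1F false _) ret-exec)) r

inc-exec : ∀ {n q x i} y → length y ≤ n →
  Exec {e} inc (q ∷ [] ∷ x ∷ y ∷ i ∷ []) (incTime n) (overflow y) (q ∷ [] ∷ x ∷ bump y ∷ i ∷ [])
inc-exec {e} {n} {q} {x} {i} y y≤ =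
  let y′ , z′ , len , eq , r = incLoop-exec {e} {q} {x} {i} y []
      z′≤ = ≤-trans len (≤-trans (≤-reflexive (+-identityʳ (length y))) y≤)
  in bind-exec (weaken-exec (+-monoˡ-≤ 6 (*-monoˡ-≤ 7 y≤)) r)
       (bind-exec (ending (λ u → q ∷ [] ∷ x ∷ u ∷ i ∷ []) 
                     (trans (sym (ʳ++-defn z′)) eq)
                     (forEach-exec 1F (λ r p → q ∷ r ∷ x ∷ (p ++ y′) ∷ i ∷ []) 3 n (λ _ _ → refl) (λ _ _ _ → refl)
                        (λ b r p _ → push-exec 3F b _) z′ z′≤))
          ret-exec)

-- After an overflow every digit is 1. A new most significant 1 can therefore be pushed at the least
-- significant end, where the stack is accessible.
carried : Symbol → String → String
carried nothing  y = y
carried (just _) y = false ∷ y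

bits-suc : ∀ m → bits (ℕᵇ.suc m) ≡ carried (overflow (bits m)) (bump (bits m))
bits-suc ℕᵇ.zero  = refl
bits-suc 1+[2 m ] = refl
bits-suc 2[1+ m ] = trans (cong (false ∷_) (bits-suc m)) (carried-∷ (overflow (bits m)))
  where
  carried-∷ : ∀ s → false ∷ carried s (bump (bits m)) ≡ carried s (false ∷ bump (bits m))
  carried-∷ nothing  = refl
  carried-∷ (just _) = refl

bits-length : ∀ k → length (bits (fromℕ' k)) ≤ k
bits-length zero    = z≤n
bits-length (suc k) = ≤-trans (≤-reflexive (cong length (bits-suc (fromℕ' k))))
  (≤-trans (carried-length (overflow y) (bump y)) (s≤s (≤-trans (≤-reflexive (bump-length y)) (bits-length k))))
  where
  y = bits (fromℕ' k)
  carried-length : ∀ s y → length (carried s y) ≤ suc (length y)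
  carried-length nothing  y = n≤1+n _
  carried-length (just _) y = ≤-refl

carry : Symbol → Code (4 + e)
carry nothing  = ret nothing
carry (just _) = push 3F false

carry-exec : ∀ s y {q t x i} → Exec {e} (carry s) (q ∷ t ∷ x ∷ y ∷ i ∷ []) 3 nothing (q ∷ t ∷ x ∷ carried s y ∷ i ∷ [])
carry-exec nothing  y = weaken-exec z≤n ret-exec
carry-exec (just _) y = push-exec 3F false _

count : Code (4 + e)
count = forEach 0F λ b → push 2F b ⨾ bind inc carry

countTime : ℕ → ℕ
countTime n = n * ((3 + suc (incTime n + 4)) + 4) + 2

count-exec : ∀ x {i} → Exec {e} count (x ∷ [] ∷ [] ∷ [] ∷ i ∷ []) (countTime (length x)) nothing
                                      ([] ∷ [] ∷ reverse x ∷ bits (fromℕ' (length x)) ∷ i ∷ [])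
count-exec x {i} = ending (λ m → [] ∷ [] ∷ reverse x ∷ bits (fromℕ' m) ∷ i ∷ []) (length-reverse x)
  (forEach-exec 0F (λ r p → r ∷ [] ∷ p ∷ bits (fromℕ' (length p)) ∷ i ∷ []) _ n (λ _ _ → refl) (λ _ _ _ → refl)
    (λ b r p le → bind-exec (push-exec 2F b _) (
      (ending (λ y → r ∷ [] ∷ (b ∷ p) ∷ y ∷ i ∷ []) (sym (bits-suc (fromℕ' (length p))))
        (bind-exec (inc-exec (bits (fromℕ' (length p)))
                     (≤-trans (bits-length (length p)) (≤-trans (m≤n+m (length p) (length r)) (<⇒≤ le))))
                   (carry-exec (overflow (bits (fromℕ' (length p)))) _)))))
    x ≤-refl)
  where n = length x

compareStep : Symbol → Symbol → Code (4 + e)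
compareStep nothing      nothing      = ret nothing
compareStep (just true)  (just true)  = ret (just true)
compareStep (just false) (just false) = ret (just true)
compareStep _            _            = ret (just false)

compareLoop comparison : Code (4 + e)
compareLoop = loop (bind (pop 1F) λ s → bind (pop 4F) (compareStep s))
comparison = forEach 3F (push 1F) ⨾ compareLoop

-- After a mismatch the unread remainders stay on stacks 1 and 4. They do no harm, since the only
-- continuation is `writeZero`, which touches stack 0 alone.
data Compared {e} (C : Code (4 + e)) (σ : Stacks) (t : ℕ) (u v q x : String) : Set where
  same    : u ≡ v → Exec C σ t nothing (q ∷ [] ∷ x ∷ [] ∷ [] ∷ []) → Compared C σ t u v q x
  differs : ∀ {w z} → u ≢ v → Exec C σ t (just false) (q ∷ w ∷ x ∷ [] ∷ z ∷ []) → Compared C σ t u v q x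

compareLoop-exec : ∀ u v {q x} → Compared {e} compareLoop (q ∷ u ∷ x ∷ [] ∷ v ∷ []) (length u * 5 + 4) u v q x
compareLoop-exec [] [] =
  same refl (stop-exec done (bind-exec (pop-exec 1F _) (bind-exec (pop-exec 4F _) ret-exec)))
compareLoop-exec [] (_ ∷ _) =
  differs (λ ()) (stop-exec failed (bind-exec (pop-exec 1F _) (bind-exec (pop-exec 4F _) ret-exec)))
compareLoop-exec (true ∷ u) [] =
  differs (λ ()) (weaken-exec (m≤n+m 4 (suc (length u) * 5))
    (stop-exec failed (bind-exec (pop-exec 1F _) (bind-exec (pop-exec 4F _) ret-exec))))
compareLoop-exec (false ∷ u) [] =
  differs (λ ()) (weaken-exec (m≤n+m 4 (suc (length u) * 5))
    (stop-exec failed (bind-exec (pop-exec 1F _) (bind-exec (pop-exec 4F _) ret-exec))))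
compareLoop-exec (true ∷ u) (false ∷ v) =
  differs (λ ()) (weaken-exec (m≤n+m 4 (suc (length u) * 5))
    (stop-exec failed (bind-exec (pop-exec 1F _) (bind-exec (pop-exec 4F _) ret-exec))))
compareLoop-exec (false ∷ u) (true ∷ v) =
  differs (λ ()) (weaken-exec (m≤n+m 4 (suc (length u) * 5))
    (stop-exec failed (bind-exec (pop-exec 1F _) (bind-exec (pop-exec 4F _) ret-exec))))
compareLoop-exec (true ∷ u) (true ∷ v) with compareLoop-exec u v
... | same eq r    = same (cong (true ∷_) eq) (next-exec (bind-exec (pop-exec 1F _) (bind-exec (pop-exec 4F _) ret-exec)) r)
... | differs ne r = differs (ne ∘ ∷-injectiveʳ) (next-exec (bind-exec (pop-exec 1F _) (bind-exec (pop-exec 4F _) ret-exec)) r)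
compareLoop-exec (false ∷ u) (false ∷ v) with compareLoop-exec u v
... | same eq r    = same (cong (false ∷_) eq) (next-exec (bind-exec (pop-exec 1F _) (bind-exec (pop-exec 4F _) ret-exec)) r)
... | differs ne r = differs (ne ∘ ∷-injectiveʳ) (next-exec (bind-exec (pop-exec 1F _) (bind-exec (pop-exec 4F _) ret-exec)) r)

compareTime : ℕ → ℕ
compareTime n = n * 7 + 2 + suc (n * 5 + 4)

comparison-exec : ∀ {n} y v {q x} → length y ≤ n →
                  Compared {e} comparison (q ∷ [] ∷ x ∷ y ∷ reverse v ∷ []) (compareTime n) y v q x
comparison-exec {e} {n} y v {q} {x} y≤ = after-reversal (compareLoop-exec (reverse y) (reverse v))
  where
  time≤ : length (reverse y) * 5 + 4 ≤ n * 5 + 4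
  time≤ = +-monoˡ-≤ 4 (*-monoˡ-≤ 5 (≤-trans (≤-reflexive (length-reverse y)) y≤))
  reversed : Exec {e} (forEach 3F (push 1F)) (q ∷ [] ∷ x ∷ y ∷ reverse v ∷ []) (n * 7 + 2) nothing
                      (q ∷ reverse y ∷ x ∷ [] ∷ reverse v ∷ [])
  reversed = forEach-exec 3F (λ r p → q ∷ p ∷ x ∷ r ∷ reverse v ∷ []) 3 n (λ _ _ → refl) (λ _ _ _ → refl)
               (λ b r p _ → push-exec 1F b _) y y≤
  after-reversal : Compared {e} compareLoop (q ∷ reverse y ∷ x ∷ [] ∷ reverse v ∷ [])
                     (length (reverse y) * 5 + 4) (reverse y) (reverse v) q x →
                   Compared comparison (q ∷ [] ∷ x ∷ y ∷ reverse v ∷ []) (compareTime n) y v q x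
  after-reversal (same eq r)    = same (reverse-injective eq) (bind-exec reversed (weaken-exec time≤ r))
  after-reversal (differs ne r) = differs (ne ∘ cong reverse) (bind-exec reversed (weaken-exec time≤ r))

-- The threshold is a constant, so the test is unrolled into the program: at most `N` bits are
-- popped and then put back.
atLeast : ℕ → Code (4 + e)
more : ℕ → Symbol → Code (4 + e)
atLeast zero    = ret (just true)
atLeast (suc N) = bind (pop 2F) (more N)
more N nothing  = ret (just false)
more N (just b) = bind (atLeast N) λ s → push 2F b ⨾ ret s

atLeast-exec : ∀ N x {q t y i} → Exec {e} (atLeast N) (q ∷ t ∷ x ∷ y ∷ i ∷ []) (N * 7 + 2) (just (N ≤ᵇ length x))
                                          (q ∷ t ∷ x ∷ y ∷ i ∷ [])
atLeast-exec zero    x       = weaken-exec z≤n ret-exec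
atLeast-exec (suc N) []      = weaken-exec (m≤n+m 2 (suc N * 7)) (bind-exec (pop-exec 2F _) ret-exec)
atLeast-exec (suc N) (b ∷ x) = weaken-exec (≤-reflexive (time≡ N)) (exiting (cong just (≤ᵇ-suc N))
  (bind-exec (pop-exec 2F _) (bind-exec (atLeast-exec N x) (bind-exec (push-exec 2F b _) ret-exec))))
  where
  ≤ᵇ-suc : ∀ N {n} → (N ≤ᵇ n) ≡ (suc N ≤ᵇ suc n)
  ≤ᵇ-suc zero    = refl
  ≤ᵇ-suc (suc N) = refl
  time≡ : ∀ N → 1 + suc (N * 7 + 2 + suc 4) ≡ suc N * 7 + 2
  time≡ = solve-∀

-- Membership tests and exhaustive search

load : Code (4 + e)
load = forEach 2F (λ b → push 3F b ⨾ push 4F b) ⨾ forEach 4F (push 2F)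

loadTime : ℕ → ℕ
loadTime n = n * 11 + 2 + suc (n * 7 + 2)

ready : String → Stacks
ready x = [] ∷ [] ∷ reverse x ∷ [] ∷ [] ∷ []

load-exec : ∀ x → Exec {e} load (ready x) (loadTime (length x)) nothing ([] ∷ [] ∷ reverse x ∷ x ∷ [] ∷ [])
load-exec {e} x = bind-exec
  (ending (λ y → [] ∷ [] ∷ [] ∷ y ∷ y ∷ []) (reverse-involutive x)
    (forEach-exec 2F (λ r p → [] ∷ [] ∷ r ∷ p ∷ p ∷ []) 7 (length x) (λ _ _ → refl) (λ _ _ _ → refl)
      (λ b r p _ → bind-exec (push-exec 3F b _) (push-exec 4F b _)) (reverse x) (≤-reflexive (length-reverse x))))
  (forEach-exec 4F (λ r p → [] ∷ [] ∷ p ∷ x ∷ r ∷ []) 3 (length x) (λ _ _ → refl) (λ _ _ _ → refl)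
    (λ b r p _ → push-exec 2F b _) x ≤-refl)

clearY : Code (4 + e)
clearY = forEach 3F λ _ → ret nothing

clearY-exec : ∀ {q t x i} y → Exec {e} clearY (q ∷ t ∷ x ∷ y ∷ i ∷ []) (length y * 4 + 2) nothing (q ∷ t ∷ x ∷ [] ∷ i ∷ [])
clearY-exec {q = q} {t} {x} {i} y =
  forEach-exec 3F (λ r _ → q ∷ t ∷ x ∷ r ∷ i ∷ []) 0 (length y) (λ _ _ → refl) (λ _ _ _ → refl)
    (λ _ _ _ _ → ret-exec) y ≤-refl

askTime : (ℕ → ℕ) → ℕ → ℕ
askTime T n = n * 11 + 2 + suc (n * 11 + 2 + suc (T n * 7 + n * 6 + 11))

-- A test has to restore the stacks, because a second test or the printing of the weight still needs
-- x.
Tests : Code (4 + e) → (ℕ → ℕ) → (String → Bool) → Set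
Tests C T b = ∀ x → Exec C (ready x) (T (length x)) (just (b x)) (ready x)

either : Code (4 + e) → Code (4 + e) → Code (4 + e)
either C D = bind C λ { (just true) → ret (just true) ; _ → D }

either-tests : ∀ {C D : Code (4 + e)} T U b d → Tests C T b → Tests D U d →
               Tests (either C D) (λ n → T n + suc (U n)) (λ x → b x ∨ d x)
either-tests T U b d Cb Dd x with b x | Cb x
... | true  | r = bind-exec r (weaken-exec z≤n ret-exec)
... | false | r = bind-exec r (Dd x)

module _ (M : Frag e) where

  -- Besides the query, `call` expects its length in unary as the initial clock. Pouring the
  -- candidate to stack 4 and back writes both and keeps the candidate for the next increment.
  ask : Code (4 + e)
  ask = forEach 3F (λ b → push 4F b ⨾ push 1F true) ⨾ forEach 4F (λ b → push 3F b ⨾ push 0F b) ⨾ call M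

  isMember : Code (4 + e)
  isMember = load ⨾ bind ask λ s → clearY ⨾ ret s

  found : Symbol → Code (4 + e)
  -- The verdict is reversed: a later member must end the loop, whereas `just true` would repeat it.
  found (just true) = ret (just false)
  found _           = ret (just true)

  examine : Symbol → Code (4 + e)
  examine nothing  = bind ask found
  examine (just _) = ret nothing

  search : Code (4 + e)
  search = loop (bind inc examine)

  conclude : Symbol → Code (4 + e)
  conclude nothing  = ret (just true)
  conclude (just _) = ret (just false)

  checkLater : Symbol → Code (4 + e)
  checkLater (just true) = bind search λ s → clearY ⨾ conclude s
  checkLater _           = clearY ⨾ ret (just false)

  isLastMember : Code (4 + e)
  isLastMember = load ⨾ bind ask checkLater

-- How often bump can be applied before it overflows.
remaining : String → ℕ
remaining []          = 0
remaining (true ∷ y)  = 2 * remaining y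
remaining (false ∷ y) = suc (2 * remaining y)

noneWithin : (String → Bool) → ℕ → String → Bool
noneWithin b zero    y = true
noneWithin b (suc k) y = not (b (bump y)) ∧ noneWithin b k (bump y)

isLast : (String → Bool) → String → Bool
isLast b x = b x ∧ noneWithin b (remaining x) x

2+2* : ∀ m → suc (suc (2 * m)) ≡ 2 * suc m
2+2* = solve-∀

-- With `false` read as 1 and `true` as 0, `remaining y` is a binary number of `length y` digits.
-- This is the source of the factor 2^n in the search time.
remaining-bound : ∀ y → suc (remaining y) ≤ 2 ^ length y
remaining-bound []          = ≤-refl
remaining-bound (true ∷ y)  = ≤-trans (s≤s (n≤1+n _))
  (≤-trans (≤-reflexive (2+2* (remaining y))) (*-monoʳ-≤ 2 (remaining-bound y)))
remaining-bound (false ∷ y) = ≤-trans (≤-reflexive (2+2* (remaining y))) (*-monoʳ-≤ 2 (remaining-bound y))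

bump-last : ∀ y → remaining y ≡ 0 → overflow y ≡ just false
bump-last []         _  = refl
bump-last (true ∷ y) eq = bump-last y (m+n≡0⇒m≡0 (remaining y) eq)

bump-next : ∀ y {k} → remaining y ≡ suc k → overflow y ≡ nothing × remaining (bump y) ≡ k
bump-next (false ∷ y) eq = refl , suc-injective eq
bump-next (true ∷ y)  eq with remaining y in r≡
bump-next (true ∷ y) refl | suc m =
  let o , r = bump-next y r≡ in o , trans (cong (λ m → suc (2 * m)) r) (sym (+-suc m (m + 0)))

module _ {M : Frag e} (T : ℕ → ℕ) {b : String → Bool} (D : Decides M T b) where

  ask-exec : ∀ y {x} → Exec (ask M) ([] ∷ [] ∷ x ∷ y ∷ [] ∷ []) (askTime T (length y)) (just (b y)) ([] ∷ [] ∷ x ∷ y ∷ [] ∷ [])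
  ask-exec y {x} = bind-exec
    (ending (λ m → [] ∷ List.replicate m true ∷ x ∷ [] ∷ reverse y ∷ []) (length-reverse y)
      (forEach-exec 3F (λ r p → [] ∷ List.replicate (length p) true ∷ x ∷ r ∷ p ∷ []) 7 n (λ _ _ → refl) (λ _ _ _ → refl)
        (λ b r p _ → bind-exec (push-exec 4F b _) (push-exec 1F true _)) y ≤-refl))
    (bind-exec
      (ending (λ z → z ∷ List.replicate n true ∷ x ∷ z ∷ [] ∷ []) (reverse-involutive y)
        (forEach-exec 4F (λ r p → p ∷ List.replicate n true ∷ x ∷ p ∷ r ∷ []) 7 n (λ _ _ → refl) (λ _ _ _ → refl)
          (λ b r p _ → bind-exec (push-exec 3F b _) (push-exec 0F b _)) (reverse y) (≤-reflexive (length-reverse y))))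
      (call-exec T D y x y []))
    where n = length y

  isMemberTime : ℕ → ℕ
  isMemberTime n = loadTime n + suc (askTime T n + suc (n * 4 + 2 + 1))

  isMember-tests : Tests (isMember M) isMemberTime b
  isMember-tests x = bind-exec (load-exec x) (bind-exec (ask-exec x) (bind-exec (clearY-exec x) ret-exec))

  roundTime : ℕ → ℕ
  roundTime n = incTime n + suc (askTime T n + 1)

  verdict : Bool → Symbol
  verdict true  = nothing
  verdict false = just false

  -- The candidate at which the search stops is left open; its length is all that the time for
  -- clearing it depends on. The time allows `k` repeated rounds and a final one.
  search-exec : ∀ k y {x} → remaining y ≡ k → ∃[ y′ ] length y′ ≡ length y ×
    Exec (search M) ([] ∷ [] ∷ x ∷ y ∷ [] ∷ []) (k * suc (roundTime (length y)) + roundTime (length y))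
         (verdict (noneWithin b k y)) ([] ∷ [] ∷ x ∷ y′ ∷ [] ∷ [])
  search-exec zero y r≡ = bump y , bump-length y ,
    stop-exec done (bind-exec (exiting (bump-last y r≡) (inc-exec y ≤-refl)) (weaken-exec z≤n ret-exec))
  search-exec (suc k) y {x} r≡ with bump-next y r≡
  ... | o≡ , r′≡ with b (bump y) | ask-exec (bump y) {x} | search-exec k (bump y) {x} r′≡
  ... | true  | r | _ = bump y , bump-length y ,
    weaken-exec (m≤n+m _ (suc k * suc (roundTime (length y))))
      (stop-exec failed
        (bind-exec (exiting o≡ (inc-exec y ≤-refl))
                   (bind-exec (lasting (cong (askTime T) (bump-length y)) r) (weaken-exec z≤n ret-exec))))
  ... | false | r | y′ , len , rest = y′ , trans len (bump-length y) ,
    weaken-exec (≤-reflexive (time≡ (roundTime (length y)) (k * suc (roundTime (length y)))))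
      (next-exec
        (bind-exec (exiting o≡ (inc-exec y ≤-refl))
                   (bind-exec (lasting (cong (askTime T) (bump-length y)) r) (weaken-exec z≤n ret-exec)))
        (lasting (cong (λ n → k * suc (roundTime n) + roundTime n) (bump-length y)) rest))
    where
    time≡ : ∀ m p → m + suc (p + m) ≡ suc m + p + m
    time≡ = solve-∀

  isLastTime : ℕ → ℕ
  isLastTime n = loadTime n + suc (askTime T n + suc (2 ^ n * suc (roundTime n) + roundTime n + suc (n * 4 + 2 + 1)))

  isLast-tests : Tests (isLastMember M) isLastTime (isLast b)
  isLast-tests x with b x | ask-exec x {reverse x} | search-exec (remaining x) x {reverse x} refl
  ... | false | r | _ = bind-exec (load-exec x) (bind-exec r
    (weaken-exec (≤-trans (n≤1+n _) (m≤n+m _ (2 ^ length x * suc (roundTime (length x)) + roundTime (length x))))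
                 (bind-exec (clearY-exec x) ret-exec)))
  ... | true | r | y′ , len , s = bind-exec (load-exec x) (bind-exec r
    (bind-exec (weaken-exec (+-monoˡ-≤ (roundTime n) (*-monoˡ-≤ (suc (roundTime n)) (<⇒≤ (remaining-bound x)))) s)
      (bind-exec (lasting (cong (λ n → n * 4 + 2) len) (clearY-exec y′)) (concluded (noneWithin b (remaining x) x)))))
    where
    n = length x
    concluded : ∀ v → Exec (conclude M (verdict v)) (ready x) 0 (just v) (ready x)
    concluded true  = ret-exec
    concluded false = ret-exec

-- Numerals and their printing

digits : String → ℕᵇ
digits []          = ℕᵇ.zero
digits (false ∷ x) = 1+[2 digits x ]
digits (true ∷ x)  = 2[1+ digits x ]

value : String → ℕ
value = ℕᵇ.toℕ ∘ digits

-- Bijective base 2 has no leading zeros, so every bit string is the numeral of a number. A weight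
-- can thus be specified by the strings to be printed, and the machine does no arithmetic on it.
encode-value : ∀ x → encodeℕ (value x) ≡ x
encode-value x = trans (cong bits (fromℕ-toℕ (digits x))) (bits-digits x)
  where
  bits-digits : ∀ x → bits (digits x) ≡ x
  bits-digits []          = refl
  bits-digits (false ∷ x) = cong (false ∷_) (bits-digits x)
  bits-digits (true ∷ x)  = cong (true ∷_) (bits-digits x)

bits-injective : ∀ {m n} → bits m ≡ bits n → m ≡ n
bits-injective {ℕᵇ.zero}  {ℕᵇ.zero}  _  = refl
bits-injective {1+[2 m ]} {1+[2 n ]} eq = cong 1+[2_] (bits-injective (∷-injectiveʳ eq))
bits-injective {2[1+ m ]} {2[1+ n ]} eq = cong 2[1+_] (bits-injective (∷-injectiveʳ eq))
bits-injective {1+[2 m ]} {2[1+ n ]} ()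
bits-injective {2[1+ m ]} {1+[2 n ]} ()

ones twos : ℕ → String
ones n = List.replicate n false
twos n = List.replicate n true

-- Least significant digit first; false is the digit 1 and true is the digit 2.
smallDenominator heavyNumerator denominator : ℕ → String
smallDenominator n = true ∷ ones n
heavyNumerator n   = true ∷ ones (n + n * n)
denominator n      = twos n ++ ones (2 + n * n)

linear : Bool → Code (4 + e)
linear c = forEach 3F (λ b → push 1F b ⨾ push 0F c) ⨾ forEach 1F (push 3F)

linearTime : ℕ → ℕ
linearTime n = n * 11 + 2 + suc (n * 7 + 2)

linear-exec : ∀ c y {q x i} → Exec {e} (linear c) (q ∷ [] ∷ x ∷ y ∷ i ∷ []) (linearTime (length y)) nothing
                                 ((List.replicate (length y) c ++ q) ∷ [] ∷ x ∷ y ∷ i ∷ [])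
linear-exec c y {q} {x} {i} = bind-exec
  (ending (λ m → (List.replicate m c ++ q) ∷ reverse y ∷ x ∷ [] ∷ i ∷ []) (length-reverse y)
    (forEach-exec 3F (λ r p → (List.replicate (length p) c ++ q) ∷ p ∷ x ∷ r ∷ i ∷ []) 7 n (λ _ _ → refl) (λ _ _ _ → refl)
      (λ b r p _ → bind-exec (push-exec 1F b _) (push-exec 0F c _)) y ≤-refl))
  (ending (λ z → (List.replicate n c ++ q) ∷ [] ∷ x ∷ z ∷ i ∷ []) (reverse-involutive y)
    (forEach-exec 1F (λ r p → (List.replicate n c ++ q) ∷ r ∷ x ∷ p ∷ i ∷ []) 3 n (λ _ _ → refl) (λ _ _ _ → refl)
      (λ b r p _ → push-exec 3F b _) (reverse y) (≤-reflexive (length-reverse y))))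
  where n = length y

square : Code (4 + e)
square = forEach 2F (λ b → push 4F b ⨾ linear false) ⨾ forEach 4F (push 2F)

squareTime : ℕ → ℕ
squareTime n = n * ((3 + suc (linearTime n)) + 4) + 2 + suc (n * 7 + 2)

replicate-++ : ∀ {A : Set} m n (a : A) (as : List A) →
               List.replicate m a ++ List.replicate n a ++ as ≡ List.replicate (m + n) a ++ as
replicate-++ zero    n a as = refl
replicate-++ (suc m) n a as = cong (a ∷_) (replicate-++ m n a as)

square-exec : ∀ x {q} → Exec {e} square (q ∷ [] ∷ reverse x ∷ x ∷ [] ∷ []) (squareTime (length x)) nothing
                                 ((ones (length x * length x) ++ q) ∷ [] ∷ reverse x ∷ x ∷ [] ∷ [])
square-exec x {q} = bind-exec
  (ending (λ (m , z) → (ones (m * n) ++ q) ∷ [] ∷ [] ∷ x ∷ z ∷ [])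
    (cong₂ _,_ (trans (length-reverse (reverse x)) (length-reverse x)) (reverse-involutive x))
    (forEach-exec 2F (λ r p → (ones (length p * n) ++ q) ∷ [] ∷ r ∷ x ∷ p ∷ []) (3 + suc (linearTime n)) n (λ _ _ → refl) (λ _ _ _ → refl)
      (λ b r p _ → bind-exec (push-exec 4F b _)
        (ending (λ z → z ∷ [] ∷ r ∷ x ∷ (b ∷ p) ∷ []) (replicate-++ n (length p * n) false q)
          (linear-exec false x)))
      (reverse x) (≤-reflexive (length-reverse x))))
  (forEach-exec 4F (λ r p → (ones (n * n) ++ q) ∷ [] ∷ p ∷ x ∷ r ∷ []) 3 n (λ _ _ → refl) (λ _ _ _ → refl)
    (λ b r p _ → push-exec 2F b _) x ≤-refl)
  where n = length x

-- A stack is filled from the end of the output: denominator, then the separator 01 of `pair`, then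
-- the doubled numerator. The doubling is why `writeHeavy` calls `square` and `linear` twice each.
writeDenominator writeHeavy writeLight writeSmall writeZero : Code (4 + e)
writeDenominator = push 0F false ⨾ push 0F false ⨾ square ⨾ linear true ⨾ push 0F true ⨾ push 0F false
writeHeavy = square ⨾ square ⨾ linear false ⨾ linear false ⨾ push 0F true ⨾ push 0F true
writeLight = push 0F false ⨾ push 0F false
writeSmall = forEach 2F (λ _ → push 0F false) ⨾ push 0F true ⨾ push 0F true ⨾ push 0F false ⨾ push 0F true ⨾ push 0F true
writeZero  = push 0F false ⨾ push 0F true ⨾ push 0F false

denominatorTime heavyTime smallTime : ℕ → ℕ
denominatorTime n = 3 + suc (3 + suc (squareTime n + suc (linearTime n + 8)))
heavyTime n = squareTime n + suc (squareTime n + suc (linearTime n + suc (linearTime n + 8)))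
smallTime n = n * 7 + 2 + 20

ones-snoc : ∀ m q → ones m ++ false ∷ q ≡ ones (suc m) ++ q
ones-snoc zero    q = refl
ones-snoc (suc m) q = cong (false ∷_) (ones-snoc m q)

writeDenominator-exec : ∀ x → Exec {e} writeDenominator ([] ∷ [] ∷ reverse x ∷ x ∷ [] ∷ []) (denominatorTime (length x)) nothing
                              ((false ∷ true ∷ denominator (length x)) ∷ [] ∷ reverse x ∷ x ∷ [] ∷ [])
writeDenominator-exec x =
  bind-exec (push-exec 0F false _) (bind-exec (push-exec 0F false _)
  (bind-exec (ending (λ z → z ∷ [] ∷ reverse x ∷ x ∷ [] ∷ []) squared (square-exec x))
  (bind-exec (linear-exec true x) (bind-exec (push-exec 0F true _) (push-exec 0F false _)))))
  where
  n = length x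
  squared : ones (n * n) ++ false ∷ false ∷ [] ≡ ones (2 + n * n)
  squared = trans (ones-snoc (n * n) _) (trans (ones-snoc (suc (n * n)) []) (++-identityʳ _))

doubled : String → String
doubled = List.concatMap (λ b → b ∷ b ∷ [])

doubled-ones : ∀ m q → doubled (ones m) ++ q ≡ ones (m + m) ++ q
doubled-ones zero    q = refl
doubled-ones (suc m) q = cong (false ∷_) (trans (cong (false ∷_) (doubled-ones m q)) (cong (λ k → ones k ++ q) (sym (+-suc m m))))

writeHeavy-exec : ∀ x {q} → Exec {e} writeHeavy ((false ∷ true ∷ q) ∷ [] ∷ reverse x ∷ x ∷ [] ∷ []) (heavyTime (length x)) nothing
                              (pair (heavyNumerator (length x)) q ∷ [] ∷ reverse x ∷ x ∷ [] ∷ [])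
writeHeavy-exec x {q} = ending (λ z → (true ∷ true ∷ z) ∷ [] ∷ reverse x ∷ x ∷ [] ∷ []) shape
  (bind-exec (square-exec x) (bind-exec (square-exec x) (bind-exec (linear-exec false x) (bind-exec (linear-exec false x)
  (bind-exec (push-exec 0F true _) (push-exec 0F true _))))))
  where
  n = length x
  rest = false ∷ true ∷ q
  count≡ : ∀ n → n + (n + (n * n + n * n)) ≡ (n + n * n) + (n + n * n)
  count≡ = solve-∀
  shape : ones n ++ ones n ++ ones (n * n) ++ ones (n * n) ++ rest ≡ doubled (ones (n + n * n)) ++ rest
  shape = trans (cong (λ z → ones n ++ ones n ++ z) (replicate-++ (n * n) (n * n) false rest))
         (trans (cong (ones n ++_) (replicate-++ n _ false rest))
         (trans (replicate-++ n _ false rest)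
         (trans (cong (λ k → ones k ++ rest) (count≡ n)) (sym (doubled-ones (n + n * n) rest)))))

writeSmall-exec : ∀ x → Exec {e} writeSmall (ready x) (smallTime (length x)) nothing
                    (pair (true ∷ []) (smallDenominator (length x)) ∷ [] ∷ [] ∷ [] ∷ [] ∷ [])
writeSmall-exec x = bind-exec
  (ending (λ m → ones m ∷ [] ∷ [] ∷ [] ∷ [] ∷ []) (trans (length-reverse (reverse x)) (length-reverse x))
    (forEach-exec 2F (λ r p → ones (length p) ∷ [] ∷ r ∷ [] ∷ [] ∷ []) 3 (length x) (λ _ _ → refl) (λ _ _ _ → refl)
      (λ b r p _ → push-exec 0F false _) (reverse x) (≤-reflexive (length-reverse x))))
  (bind-exec (push-exec 0F true _) (bind-exec (push-exec 0F true _) (bind-exec (push-exec 0F false _)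
  (bind-exec (push-exec 0F true _) (push-exec 0F true _)))))

-- The machine that prints a weight

module _ (N : ℕ) (heavy : String → Bool) where

  massBits : ℕ → String → String × String
  massBits i x with length x ≟ i
  ... | no _  = [] , false ∷ []
  ... | yes _ with N ≤ᵇ length x
  -- The uniform weight is given as 2/2^(n+1), because the numeral of 2^(n+1) has the same shape for
  -- all n, while that of 2^n is an exception at n = 0.
  ...   | false = true ∷ [] , smallDenominator (length x)
  ...   | true  = (if heavy x then heavyNumerator (length x) else false ∷ []) , denominator (length x)

  mass : ℕ × String → ℕ × ℕ
  mass (i , x) = let (a , b) = massBits i x in value a , value b

  module _ (test : Code (4 + e)) where

    writeMass : Symbol → Code (4 + e)
    writeMass (just true) = load ⨾ writeDenominator ⨾ writeHeavy
    writeMass _           = load ⨾ writeDenominator ⨾ writeLight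

    onEnough : Symbol → Code (4 + e)
    onEnough (just true) = bind test writeMass
    onEnough _           = writeSmall

    onCompared : Symbol → Code (4 + e)
    onCompared nothing = bind (atLeast N) onEnough
    onCompared _       = writeZero

    massCode : Code (4 + e)
    massCode = parse ⨾ count ⨾ bind comparison onCompared

    module _ {T : ℕ → ℕ} (tests : Tests test T heavy) where

      writeTime enoughTime afterTime : ℕ → ℕ
      writeTime n  = loadTime n + suc (denominatorTime n + suc (heavyTime n + 7))
      enoughTime n = T n + suc (writeTime n) + smallTime n
      afterTime n  = countTime n + suc (compareTime n + suc (N * 7 + 2 + suc (enoughTime n) + 11))

      -- Only stack 0 is read as output. Forgetting the verdict and the other stacks gives branches
      -- with different endings a common type.
      Writes : Code (4 + e) → Stacks → ℕ → String → Set
      Writes C σ t z = ∃[ s ] ∃[ σ′ ] Exec C σ t s (z ∷ σ′)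

      then : ∀ {C K σ t s σ′ u z} → Exec C σ t s σ′ → Writes (K s) σ′ u z → Writes (bind C K) σ (t + suc u) z
      then r (s , σ″ , k) = s , σ″ , bind-exec r k

      within : ∀ {C σ t u z} → t ≤ u → Writes C σ t z → Writes C σ u z
      within le (s , σ′ , r) = s , σ′ , weaken-exec le r

      writeMass-exec : ∀ b x → Writes (writeMass (just b)) (ready x) (writeTime (length x))
        (pair (if b then heavyNumerator (length x) else false ∷ []) (denominator (length x)))
      writeMass-exec true x = within (+-monoʳ-≤ (loadTime n) (s≤s (+-monoʳ-≤ (denominatorTime n) (s≤s (m≤m+n (heavyTime n) 7)))))
        (then (load-exec x) (then (writeDenominator-exec x) (_ , _ , writeHeavy-exec x)))
        where n = length x
      writeMass-exec false x = within (+-monoʳ-≤ (loadTime n) (s≤s (+-monoʳ-≤ (denominatorTime n) (s≤s (m≤n+m 7 (heavyTime n))))))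
        (then (load-exec x) (then (writeDenominator-exec x) (_ , _ , bind-exec (push-exec 0F false _) (push-exec 0F false _))))
        where n = length x

      -- The machine compares numerals and `massBits` compares numbers; injectivity of `bits` rules
      -- out the two mixed cases. The counter follows `fromℕ'`, which recurses on successors, while
      -- `encodeℕ` uses `fromℕ`.
      afterParse-exec : ∀ i x → Writes (count ⨾ bind comparison onCompared) (x ∷ [] ∷ [] ∷ [] ∷ reverse (encodeℕ i) ∷ [])
                                       (afterTime (length x)) (uncurry pair (massBits i x))
      afterParse-exec i x with comparison-exec {e} (bits (fromℕ' (length x))) (encodeℕ i) {[]} {reverse x} (bits-length (length x))
                            | length x ≟ i
      ... | same eq r | no i≢ = contradiction (sym (i≡ eq)) i≢
        where
        i≡ : bits (fromℕ' (length x)) ≡ encodeℕ i → i ≡ length x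
        i≡ eq = trans (sym (toℕ-fromℕ i)) (trans (cong ℕᵇ.toℕ (sym (bits-injective eq))) (toℕ-fromℕ' (length x)))
      ... | differs ne r | yes refl = contradiction (cong bits (sym (fromℕ≡fromℕ' (length x)))) ne
      ... | differs ne r | no _ =
        then (count-exec x) (within (+-monoʳ-≤ (compareTime n) (s≤s (m≤n+m 11 (N * 7 + 2 + suc (enoughTime n)))))
          (then r (_ , _ , bind-exec (push-exec 0F false _) (bind-exec (push-exec 0F true _) (push-exec 0F false _)))))
        where n = length x
      ... | same _ r | yes refl with N ≤ᵇ length x
                                    | exiting (cong (λ m → just (N ≤ᵇ m)) (length-reverse x)) (atLeast-exec {e} N (reverse x) {[]} {[]} {[]} {[]})
      ...   | false | l =
        then (count-exec x) (then r (within (≤-trans (+-monoʳ-≤ (N * 7 + 2) (s≤s (m≤n+m (smallTime n) (T n + suc (writeTime n)))))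
                                                     (m≤m+n (N * 7 + 2 + suc (enoughTime n)) 11))
          (then l (_ , _ , writeSmall-exec x))))
        where n = length x
      ...   | true | l =
        then (count-exec x) (then r (within (≤-trans (+-monoʳ-≤ (N * 7 + 2) (s≤s (m≤m+n (T n + suc (writeTime n)) (smallTime n))))
                                                     (m≤m+n (N * 7 + 2 + suc (enoughTime n)) 11))
          (then l (then (tests x) (writeMass-exec (heavy x) x)))))
        where n = length x

      massCode-exec : ∀ i x → ∃[ s ] ∃[ σ ] Exec massCode (encodeℕ×String (i , x) ∷ [] ∷ [] ∷ [] ∷ [] ∷ [])
        (length (encodeℕ i) * 9 + 4 + suc (afterTime (length x))) s (encodeℕ×ℕ (mass (i , x)) ∷ σ)
      massCode-exec i x =
        let s , σ , r = then (parse-exec (encodeℕ i)) (afterParse-exec i x)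
        in s , σ , ending (λ z → z ∷ σ) 
             (sym (cong₂ pair (encode-value (proj₁ (massBits i x))) (encode-value (proj₂ (massBits i x))))) r

-- Time bounds

eval-mono : ∀ p {m n} → m ≤ n → eval p m ≤ eval p n
eval-mono []      _  = z≤n
eval-mono (a ∷ p) le = +-monoʳ-≤ a (*-mono-≤ le (eval-mono p le))

addPoly mulPoly : Poly → Poly → Poly
addPoly []      q       = q
addPoly (a ∷ p) []      = a ∷ p
addPoly (a ∷ p) (b ∷ q) = a + b ∷ addPoly p q
mulPoly []      q = []
mulPoly (a ∷ p) q = addPoly (List.map (a *_) q) (0 ∷ mulPoly p q)

eval-add : ∀ p q n → eval (addPoly p q) n ≡ eval p n + eval q n
eval-add []      q       n = refl
eval-add (a ∷ p) []      n = sym (+-identityʳ _)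
eval-add (a ∷ p) (b ∷ q) n =
  trans (cong (λ m → a + b + n * m) (eval-add p q n)) (rearrange a b n (eval p n) (eval q n))
  where
  rearrange : ∀ a b n u v → a + b + n * (u + v) ≡ a + n * u + (b + n * v)
  rearrange = solve-∀

eval-scale : ∀ a q n → eval (List.map (a *_) q) n ≡ a * eval q n
eval-scale a []      n = sym (*-zeroʳ a)
eval-scale a (b ∷ q) n = trans (cong (λ m → a * b + n * m) (eval-scale a q n)) (rearrange a b n (eval q n))
  where
  rearrange : ∀ a b n u → a * b + n * (a * u) ≡ a * (b + n * u)
  rearrange = solve-∀

eval-mul : ∀ p q n → eval (mulPoly p q) n ≡ eval p n * eval q n
eval-mul []      q n = refl
eval-mul (a ∷ p) q n =
  trans (eval-add (List.map (a *_) q) (0 ∷ mulPoly p q) n)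
  (trans (cong₂ (λ u v → u + n * v) (eval-scale a q n) (eval-mul p q n)) (rearrange a n (eval p n) (eval q n)))
  where
  rearrange : ∀ a n u v → a * v + n * (u * v) ≡ (a + n * u) * v
  rearrange = solve-∀

-- A scale of time bounds, indexed by polynomials, that is closed under sums and products.
record Growth : Set₁ where
  infixl 6 _⊕_
  infixl 7 _⊗_
  field bound : Poly → ℕ → ℕ

  Bounded : (ℕ → ℕ) → Set
  Bounded f = ∃[ p ] ∀ n → f n ≤ bound p n

  field
    bound-mono : ∀ p {m n} → m ≤ n → bound p m ≤ bound p n
    constant   : ∀ c → Bounded (const c)
    identity   : Bounded id
    _⊕_        : ∀ {f g} → Bounded f → Bounded g → Bounded (λ n → f n + g n)
    _⊗_        : ∀ {f g} → Bounded f → Bounded g → Bounded (λ n → f n * g n)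

  successor : ∀ {f} → Bounded f → Bounded (suc ∘ f)
  successor = constant 1 ⊕_

polynomial : Growth
polynomial = record
  { bound      = eval
  ; bound-mono = eval-mono
  ; constant   = λ c → c ∷ [] , λ n → m≤m+n c (n * 0)
  ; identity   = 0 ∷ 1 ∷ [] , λ n → ≤-reflexive (sym (id≡ n))
  ; _⊕_        = λ { (p , f≤) (q , g≤) → addPoly p q , λ n →
                   ≤-trans (+-mono-≤ (f≤ n) (g≤ n)) (≤-reflexive (sym (eval-add p q n))) }
  ; _⊗_        = λ { (p , f≤) (q , g≤) → mulPoly p q , λ n →
                   ≤-trans (*-mono-≤ (f≤ n) (g≤ n)) (≤-reflexive (sym (eval-mul p q n))) } }
  where
  id≡ : ∀ n → 0 + n * (1 + n * 0) ≡ n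
  id≡ = solve-∀

n<2^n : ∀ n → n < 2 ^ n
n<2^n zero    = s≤s z≤n
n<2^n (suc n) = ≤-trans (+-mono-≤ (m^n>0 2 n) (n<2^n n)) (≤-reflexive (cong (2 ^ n +_) (sym (+-identityʳ (2 ^ n)))))

-- A product adds the exponents, a sum costs one more, and polynomial bounds enter through n < 2^n.
exponential : Growth
exponential = record
  { bound      = λ p n → 2 ^ eval p n
  ; bound-mono = λ p le → ^-monoʳ-≤ 2 (eval-mono p le)
  ; constant   = λ c → raise (constant c)
  ; identity   = raise identity
  ; _⊕_        = λ { (p , f≤) (q , g≤) → addPoly (1 ∷ []) (addPoly p q) , λ n →
      let u = eval p n ; v = eval q n in begin
        _                        ≤⟨ +-mono-≤ (f≤ n) (g≤ n) ⟩
        2 ^ u + 2 ^ v            ≤⟨ +-mono-≤ (^-monoʳ-≤ 2 (m≤m+n u v)) (^-monoʳ-≤ 2 (m≤n+m v u)) ⟩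
        2 ^ (u + v) + 2 ^ (u + v) ≡⟨ cong (2 ^ (u + v) +_) (sym (+-identityʳ (2 ^ (u + v)))) ⟩
        2 ^ suc (u + v)          ≡⟨ cong (2 ^_) (sym (suc≡ p q n)) ⟩
        2 ^ eval (addPoly (1 ∷ []) (addPoly p q)) n ∎ }
  ; _⊗_        = λ { (p , f≤) (q , g≤) → addPoly p q , λ n → begin
        _                            ≤⟨ *-mono-≤ (f≤ n) (g≤ n) ⟩
        2 ^ eval p n * 2 ^ eval q n  ≡⟨ sym (^-distribˡ-+-* 2 (eval p n) (eval q n)) ⟩
        2 ^ (eval p n + eval q n)    ≡⟨ cong (2 ^_) (sym (eval-add p q n)) ⟩
        2 ^ eval (addPoly p q) n     ∎ } }
  where
  open Growth polynomial using (constant; identity)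
  open ≤-Reasoning
  raise : ∀ {f} → Growth.Bounded polynomial f → ∃[ p ] ∀ n → f n ≤ 2 ^ eval p n
  raise (p , f≤) = p , λ n → ≤-trans (f≤ n) (<⇒≤ (n<2^n (eval p n)))
  suc≡ : ∀ p q n → eval (addPoly (1 ∷ []) (addPoly p q)) n ≡ suc (eval p n + eval q n)
  suc≡ p q n = trans (eval-add (1 ∷ []) (addPoly p q) n) (cong₂ _+_ (cong suc (*-zeroʳ n)) (eval-add p q n))

module Bounds (G : Growth) where
  open Growth G

  incTime-bounded : Bounded incTime
  incTime-bounded = identity ⊗ constant 7 ⊕ constant 6 ⊕ successor (identity ⊗ constant 7 ⊕ constant 2 ⊕ constant 1)

  loadTime-bounded : Bounded loadTime
  loadTime-bounded = identity ⊗ constant 11 ⊕ constant 2 ⊕ successor (identity ⊗ constant 7 ⊕ constant 2)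

  linearTime-bounded : Bounded linearTime
  linearTime-bounded = loadTime-bounded

  squareTime-bounded : Bounded squareTime
  squareTime-bounded = identity ⊗ (constant 3 ⊕ successor linearTime-bounded ⊕ constant 4) ⊕ constant 2
                       ⊕ successor (identity ⊗ constant 7 ⊕ constant 2)

  heavyTime-bounded : Bounded heavyTime
  heavyTime-bounded = squareTime-bounded ⊕ successor (squareTime-bounded ⊕ successor (linearTime-bounded ⊕
                      successor (linearTime-bounded ⊕ constant 8)))

  denominatorTime-bounded : Bounded denominatorTime
  denominatorTime-bounded = constant 3 ⊕ successor (constant 3 ⊕ successor (squareTime-bounded ⊕ successor (linearTime-bounded ⊕ constant 8)))

  askTime-bounded : ∀ {T} → Bounded T → Bounded (askTime T)
  askTime-bounded T≤ = identity ⊗ constant 11 ⊕ constant 2 ⊕ successor (identity ⊗ constant 11 ⊕ constant 2 ⊕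
                       successor (T≤ ⊗ constant 7 ⊕ identity ⊗ constant 6 ⊕ constant 11))

  clearing : Bounded (λ n → n * 4 + 2 + 1)
  clearing = identity ⊗ constant 4 ⊕ constant 2 ⊕ constant 1

  countTime-bounded : Bounded countTime
  countTime-bounded = identity ⊗ (constant 3 ⊕ successor (incTime-bounded ⊕ constant 4) ⊕ constant 4) ⊕ constant 2

  isMemberTime-bounded : ∀ {M : Frag e} T {b} (D : Decides M T b) → Bounded T → Bounded (isMemberTime T D)
  isMemberTime-bounded T D T≤ = loadTime-bounded ⊕ successor (askTime-bounded T≤ ⊕ successor clearing)

  -- The hypothesis on `2 ^_` is the one place where the exhaustive search demands the exponential
  -- scale; the rest of the analysis is shared by both scales.
  isLastTime-bounded : ∀ {M : Frag e} T {b} (D : Decides M T b) → Bounded T → Bounded (2 ^_) → Bounded (isLastTime T D)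
  isLastTime-bounded T D T≤ 2^≤ = loadTime-bounded ⊕ successor (askTime-bounded T≤ ⊕
    successor (2^≤ ⊗ successor round ⊕ round ⊕ successor clearing))
    where
    round : Bounded (roundTime T D)
    round = incTime-bounded ⊕ successor (askTime-bounded T≤ ⊕ constant 1)

  module _ (N : ℕ) (heavy : String → Bool) (test : Code (4 + e)) {T : ℕ → ℕ} (tests : Tests test T heavy) (T≤ : Bounded T) where

    afterTime-bounded : Bounded (afterTime N heavy test {T} tests)
    afterTime-bounded = countTime-bounded ⊕ successor (compareTime-bounded ⊕ successor (constant (N * 7 + 2) ⊕
      successor (T≤ ⊕ successor writing ⊕ (identity ⊗ constant 7 ⊕ constant 2 ⊕ constant 20)) ⊕ constant 11))
      where
      compareTime-bounded : Bounded compareTime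
      compareTime-bounded = identity ⊗ constant 7 ⊕ constant 2 ⊕ successor (identity ⊗ constant 5 ⊕ constant 4)
      writing : Bounded (writeTime N heavy test {T} tests)
      writing = loadTime-bounded ⊕ successor (denominatorTime-bounded ⊕ successor (heavyTime-bounded ⊕ constant 7))

    mass-computable : ∃[ p ] ComputableInTime (bound p) encodeℕ×String encodeℕ×ℕ (mass N heavy)
    mass-computable =
      let p , after≤ = afterTime-bounded
          -- `bound p` replaces `afterTime` here because it is monotone, so the estimate passes from
          -- the length of x to that of the whole encoded input.
          q , total≤ = identity ⊗ constant 9 ⊕ constant 4 ⊕ successor (p , λ n → ≤-refl {bound p n})
      in q , machine (compile (massCode N heavy test)) , λ (i , x) →
         let s , σ , exec (runs t≤ r _) = massCode-exec N heavy test {T} tests i x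
             u = encodeℕ i
             u≤ = ≤-trans (m≤m*n (length u) 2) (≤-trans (m≤m+n (length u * 2) _) (≤-reflexive (sym (length-pair u x))))
             x≤ = ≤-trans (m≤n+m (length x) (length u * 2 + 2))
                    (≤-reflexive (trans (+-assoc (length u * 2) 2 (length x)) (sym (length-pair u x))))
         in _ , _ ,
            ≤-trans t≤ (≤-trans (+-mono-≤ (+-monoˡ-≤ 4 (*-monoˡ-≤ 9 u≤)) (s≤s (≤-trans (after≤ (length x)) (bound-mono p x≤))))
                                (total≤ (length (pair u x)))) ,
            r , read-input (encodeℕ×ℕ (mass N heavy (i , x)))
      where
      length-pair : ∀ u x → length (pair u x) ≡ length u * 2 + (2 + length x)
      length-pair []      x = refl
      length-pair (_ ∷ u) x = cong (2 +_) (length-pair u x)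
      read-input : ∀ z → readTape (inputTape z) ≡ z
      read-input []      = refl
      read-input (b ∷ z) = cong (b ∷_) (leading z)
        where
        leading : ∀ z → leadingBits (List.map just z) ≡ z
        leading []      = refl
        leading (b ∷ z) = cong (b ∷_) (leading z)

-- Boolean tests from membership in P

module _ (M : TM) where
  open TM M using (_⇓[_]_; halt; next; config)

  deterministic : ∀ {c t d t′ d′} → c ⇓[ t ] d → c ⇓[ t′ ] d′ → d ≡ d′
  deterministic (halt _)   (halt _)     = refl
  deterministic (halt eq)  (next eq′ _) with trans (sym eq) eq′
  ... | ()
  deterministic (next eq _) (halt eq′)  with trans (sym eq) eq′
  ... | ()
  deterministic (next eq r) (next eq′ r′) with trans (sym eq) eq′
  ... | refl = deterministic r r′

  decider : Frag (TM.extraTapes M)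
  decider = record { State = TM.State M ; finite = TM.finite M ; start = TM.start M ; exit = just ∘ TM.accept M ; δ = TM.δ M }

  decider-run : ∀ {q ts t q′ ts′} → config q ts ⇓[ t ] config q′ ts′ → _⟶[_]_ decider (q , ts) t (q′ , ts′)
  decider-run {q} {ts} (halt eq) with TM.δ M q (Vec.map head ts) in δ≡
  ... | nothing = halt-at decider δ≡
  decider-run {q} {ts} (next eq r) with TM.δ M q (Vec.map head ts) in δ≡
  decider-run (next refl r) | just _ = next-at decider δ≡ (decider-run r)

-- `Pos` and `Neg` are predicates, but singling out heavy strings takes a Boolean test. The verdict
-- of a machine that always halts supplies one.
record Decidable (L : Language) : Set₁ where
  field
    {extra}  : ℕ
    program  : Frag extra
    poly     : Poly
    member   : String → Bool
    decides  : Decides program (eval poly) member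
    sound    : ∀ x → member x ≡ true → L x
    complete : ∀ x → L x → member x ≡ true

decidable : ∀ {L} → InP L → Decidable L
decidable (M , (p , time) , L⇔) = record
  { program  = decider M
  ; poly     = p
  ; member   = λ x → TM.accept M (TM.state (proj₁ (proj₂ (time x))))
  ; decides  = λ x → let t , d , t≤ , r = time x in TM.contents d , runs t≤ (decider-run M r) refl
  ; sound    = λ x eq → let t , d , _ , r = time x in Equivalence.from (L⇔ x) (t , d , r , eq)
  -- Acceptance may be witnessed by any run; determinism identifies its end with that of the run
  -- within the time bound.
  ; complete = λ x l → let t , d , r , eq = Equivalence.to (L⇔ x) l
                       in trans (cong (TM.accept M ∘ TM.state) (deterministic M (proj₂ (proj₂ (proj₂ (time x)))) r)) eq }

-- Weights

ratio : ℕ → (b : ℕ) .{{_ : NonZero b}} → ℚ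
ratio a b = ℤ.+ a ℚ./ b

-- `ℚ./` reduces to lowest terms, so the comparison goes through unnormalised fractions, where it is
-- cross-multiplication.
ratio-≤ : ∀ a b c d .{{_ : NonZero b}} .{{_ : NonZero d}} → a * d ≤ c * b → ratio a b ℚ.≤ ratio c d
ratio-≤ a b@(suc _) c d@(suc _) le = ℚ.toℚᵘ-cancel-≤
  (ℚᵘ.≤-respʳ-≃ (ℚᵘ.≃-sym (ℚ.toℚᵘ-fromℚᵘ (ℤ.+ c ℚᵘ./ d))) (ℚᵘ.≤-respˡ-≃ (ℚᵘ.≃-sym (ℚ.toℚᵘ-fromℚᵘ (ℤ.+ a ℚᵘ./ b)))
    (ℚᵘ.*≤* (subst₂ ℤ._≤_ (ℤ.pos-* a d) (ℤ.pos-* c b) (ℤ.+≤+ le)))))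

ratio-< : ∀ a b c d .{{_ : NonZero b}} .{{_ : NonZero d}} → a * d < c * b → ratio a b ℚ.< ratio c d
ratio-< a b@(suc _) c d@(suc _) lt = ℚ.toℚᵘ-cancel-<
  (ℚᵘ.<-respʳ-≃ (ℚᵘ.≃-sym (ℚ.toℚᵘ-fromℚᵘ (ℤ.+ c ℚᵘ./ d))) (ℚᵘ.<-respˡ-≃ (ℚᵘ.≃-sym (ℚ.toℚᵘ-fromℚᵘ (ℤ.+ a ℚᵘ./ b)))
    (ℚᵘ.*<* (subst₂ ℤ._<_ (ℤ.pos-* a d) (ℤ.pos-* c b) (ℤ.+<+ lt)))))

ratio-≡ : ∀ a b c d .{{_ : NonZero b}} .{{_ : NonZero d}} → a * d ≡ c * b → ratio a b ≡ ratio c d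
ratio-≡ a b c d eq = ℚ.≤-antisym (ratio-≤ a b c d (≤-reflexive eq)) (ratio-≤ c d a b (≤-reflexive (sym eq)))

ratio-+ : ∀ a b d .{{_ : NonZero d}} → ratio a d ℚ.+ ratio b d ≡ ratio (a + b) d
ratio-+ a b d@(suc d-1) = ℚ.toℚᵘ-injective (ℚᵘ.≃-trans (ℚ.toℚᵘ-homo-+ (ratio a d) (ratio b d))
  (ℚᵘ.≃-trans (ℚᵘ.+-cong (ℚ.toℚᵘ-fromℚᵘ (ℤ.+ a ℚᵘ./ d)) (ℚ.toℚᵘ-fromℚᵘ (ℤ.+ b ℚᵘ./ d)))
  (ℚᵘ.≃-trans (ℚᵘ.*≡* cross) (ℚᵘ.≃-sym (ℚ.toℚᵘ-fromℚᵘ (ℤ.+ (a + b) ℚᵘ./ d))))))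
  where
  nat : ∀ a b d → (a * d + b * d) * d ≡ (a + b) * (d * d)
  nat = solve-∀
  cross : (ℤ.+ a ℤ.* ℤ.+ d ℤ.+ ℤ.+ b ℤ.* ℤ.+ d) ℤ.* ℤ.+ d ≡ ℤ.+ (a + b) ℤ.* ℤ.+ (d * d)
  cross = trans (cong₂ (λ u v → (u ℤ.+ v) ℤ.* ℤ.+ d) (sym (ℤ.pos-* a d)) (sym (ℤ.pos-* b d)))
         (trans (sym (ℤ.pos-* (a * d + b * d) d)) (trans (cong ℤ.+_ (nat a b d)) (ℤ.pos-* (a + b) (d * d))))

tally : (String → ℕ) → List String → ℕ
tally f []       = 0
tally f (x ∷ xs) = f x + tally f xs

tally-+ : ∀ f g xs → tally (λ x → f x + g x) xs ≡ tally f xs + tally g xs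
tally-+ f g []       = refl
tally-+ f g (x ∷ xs) = trans (cong (f x + g x +_) (tally-+ f g xs)) (interchange (f x) (g x) (tally f xs) (tally g xs))
  where
  interchange : ∀ a b c d → a + b + (c + d) ≡ a + c + (b + d)
  interchange = solve-∀

tally-++ : ∀ f xs ys → tally f (xs ++ ys) ≡ tally f xs + tally f ys
tally-++ f []       ys = refl
tally-++ f (x ∷ xs) ys = trans (cong (f x +_) (tally-++ f xs ys)) (sym (+-assoc (f x) _ _))

tally-map : ∀ f (g : String → String) xs → tally f (List.map g xs) ≡ tally (f ∘ g) xs
tally-map f g []       = refl
tally-map f g (x ∷ xs) = cong (f (g x) +_) (tally-map f g xs)

tally-const : ∀ c xs → tally (const c) xs ≡ c * length xs
tally-const c []       = sym (*-zeroʳ c)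
tally-const c (x ∷ xs) = trans (cong (c +_) (tally-const c xs)) (sym (*-suc c (length xs)))

tally-cong : ∀ {P : String → Set} {f g xs} → ListAll.All P xs → (∀ {x} → P x → f x ≡ g x) → tally f xs ≡ tally g xs
tally-cong []       eq = refl
tally-cong (p ∷ ps) eq = cong₂ _+_ (eq p) (tally-cong ps eq)

infix 4 _≟ₛ_
_≟ₛ_ : (x y : String) → Dec (x ≡ y)
_≟ₛ_ = ≡-dec Bool._≟_

spike : ℕ → String → String → ℕ
spike k p x = if does (x ≟ₛ p) then k else 0

tally-spike : ∀ k p → tally (spike k p) (strings (length p)) ≡ k
tally-spike k []      = +-identityʳ k
tally-spike k (c ∷ p) = trans (tally-++ (spike k (c ∷ p)) (List.map (false ∷_) xs) (List.map (true ∷_) xs))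
  (trans (cong₂ _+_ (tally-map (spike k (c ∷ p)) (false ∷_) xs) (tally-map (spike k (c ∷ p)) (true ∷_) xs)) (halves c))
  where
  xs = strings (length p)
  halves : ∀ c → tally (spike k (c ∷ p) ∘ (false ∷_)) xs + tally (spike k (c ∷ p) ∘ (true ∷_)) xs ≡ k
  halves false = trans (cong₂ _+_ (tally-spike k p) (tally-const 0 xs)) (+-identityʳ k)
  halves true  = cong₂ _+_ (tally-const 0 xs) (tally-spike k p)

length-strings : ∀ n → length (strings n) ≡ 2 ^ n
length-strings zero    = refl
length-strings (suc n) = trans (length-++ (List.map (false ∷_) (strings n)))
  (cong₂ _+_ (trans (length-map (false ∷_) (strings n)) (length-strings n))
             (trans (trans (length-map (true ∷_) (strings n)) (length-strings n)) (sym (+-identityʳ (2 ^ n)))))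

strings-length : ∀ n → ListAll.All (λ x → length x ≡ n) (strings n)
strings-length zero    = refl ∷ []
strings-length (suc n) = ListAll.++⁺ (ListAll.map⁺ (ListAll.map (cong suc) (strings-length n)))
                                     (ListAll.map⁺ (ListAll.map (cong suc) (strings-length n)))

∈-strings : ∀ x → x ∈ strings (length x)
∈-strings []          = here refl
∈-strings (false ∷ x) = ∈-++⁺ˡ (∈-map⁺ (false ∷_) (∈-strings x))
∈-strings (true ∷ x)  = ∈-++⁺ʳ (List.map (false ∷_) (strings (length x))) (∈-map⁺ (true ∷_) (∈-strings x))

sum-ratio : ∀ {P : String → Set} {w f xs} d .{{_ : NonZero d}} → ListAll.All P xs →
            (∀ {x} → P x → w x ≡ ratio (f x) d) → sum w xs ≡ ratio (tally f xs) d
sum-ratio d []       eq = ratio-≡ 0 1 0 d refl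
sum-ratio {f = f} {xs = x ∷ xs} d (p ∷ ps) eq = trans (cong₂ ℚ._+_ (eq p) (sum-ratio {f = f} d ps eq)) (ratio-+ (f x) (tally f xs) d)

module _ (w : String → ℚ) {E : Language} where

  weight-≥0 : (∀ x → 0ℚ ℚ.≤ w x) → ∀ {xs} (ds : ListAll.All (λ x → Dec (E x)) xs) → 0ℚ ℚ.≤ weight w ds
  weight-≥0 w≥0 []                     = ℚ.≤-refl
  weight-≥0 w≥0 (_∷_ {x} (yes _) ds) = ℚ.+-mono-≤ (w≥0 x) (weight-≥0 w≥0 ds)
  weight-≥0 w≥0 (_∷_ {x} (no _) ds)  = ℚ.+-mono-≤ (ℚ.≤-refl {0ℚ}) (weight-≥0 w≥0 ds)

  weight-member : (∀ x → 0ℚ ℚ.≤ w x) → ∀ {x xs} (ds : ListAll.All (λ x → Dec (E x)) xs) → x ∈ xs → E x → w x ℚ.≤ weight w ds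
  weight-member w≥0 {x} (yes _ ∷ ds)  (here refl) e =
    ℚ.≤-trans (ℚ.≤-reflexive (sym (ℚ.+-identityʳ (w x)))) (ℚ.+-mono-≤ (ℚ.≤-refl {w x}) (weight-≥0 w≥0 ds))
  weight-member w≥0     (no ¬e ∷ ds)  (here refl) e = contradiction e ¬e
  weight-member w≥0 {x} (_∷_ {y} d ds) (there x∈) e =
    ℚ.≤-trans (ℚ.≤-reflexive (sym (ℚ.+-identityˡ (w x)))) (ℚ.+-mono-≤ (first d) (weight-member w≥0 ds x∈ e))
    where
    first : (d : Dec (E y)) → 0ℚ ℚ.≤ (if does d then w y else 0ℚ)
    first (yes _) = w≥0 y
    first (no _)  = ℚ.≤-refl

  weight-complement : ∀ {xs} (ds : ListAll.All (λ x → Dec (E x)) xs) → weight w ds ℚ.+ weight w (ListAll.map ¬? ds) ≡ sum w xs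
  weight-complement []       = refl
  weight-complement (_∷_ {x} {xs} d ds) = trans (interchange (here-part d) r (there-part d) s) (cong₂ ℚ._+_ (parts d) (weight-complement ds))
    where
    r = weight w ds
    s = weight w (ListAll.map ¬? ds)
    here-part there-part : Dec (E x) → ℚ
    here-part d = if does d then w x else 0ℚ
    there-part d = if does (¬? d) then w x else 0ℚ
    parts : ∀ d → here-part d ℚ.+ there-part d ≡ w x
    parts (yes _) = ℚ.+-identityʳ (w x)
    parts (no _)  = ℚ.+-identityˡ (w x)
    interchange : ∀ a b c d → (a ℚ.+ b) ℚ.+ (c ℚ.+ d) ≡ (a ℚ.+ c) ℚ.+ (b ℚ.+ d)
    interchange a b c d = trans (ℚ.+-assoc a b _) (trans (cong (a ℚ.+_)
      (trans (sym (ℚ.+-assoc b c d)) (trans (cong (ℚ._+ d) (ℚ.+-comm b c)) (ℚ.+-assoc c b d)))) (sym (ℚ.+-assoc a c _)))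

  weight-≤ : ∀ {P : String → Set} {xs} d .{{_ : NonZero d}} (ds : ListAll.All (λ x → Dec (E x)) xs) → ListAll.All P xs →
             (∀ {x} → P x → E x → w x ℚ.≤ ratio 1 d) → weight w ds ℚ.≤ ratio (length xs) d
  weight-≤ d []        []       _ = ratio-≤ 0 1 0 d z≤n
  weight-≤ {xs = x ∷ xs} d (c ∷ ds) (p ∷ ps) le =
    ℚ.≤-trans (ℚ.+-mono-≤ (first c) (weight-≤ d ds ps le)) (ℚ.≤-reflexive (ratio-+ 1 (length xs) d))
    where
    first : (c : Dec (E x)) → (if does c then w x else 0ℚ) ℚ.≤ ratio 1 d
    first (yes e) = le p e
    first (no _)  = ratio-≤ 0 1 1 d z≤n

value-ones : ∀ m → suc (value (ones m)) ≡ 2 ^ m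
value-ones zero    = refl
value-ones (suc m) = trans (2+2* (value (ones m))) (cong (2 *_) (value-ones m))

-- Prepending the digit 2 sends v to 2v + 2, which doubles v + 2.
value-twos : ∀ n s → value (twos n ++ s) + 2 ≡ 2 ^ n * (value s + 2)
value-twos zero    s = sym (+-identityʳ _)
value-twos (suc n) s = trans (step (value (twos n ++ s))) (trans (cong (2 *_) (value-twos n s)) (sym (*-assoc 2 (2 ^ n) _)))
  where
  step : ∀ v → 2 * suc v + 2 ≡ 2 * (v + 2)
  step = solve-∀

value-small : ∀ n → value (smallDenominator n) ≡ 2 ^ suc n
value-small n = cong (2 *_) (value-ones n)

value-heavy : ∀ n → value (heavyNumerator n) ≡ 2 ^ suc (n + n * n)
value-heavy n = cong (2 *_) (value-ones (n + n * n))

-- Stated with 2 added to both sides, to avoid subtraction.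
value-denominator : ∀ n → value (denominator n) + 2 ≡ 2 ^ n + (value (heavyNumerator n) + value (heavyNumerator n))
value-denominator n = begin
  value (denominator n) + 2                ≡⟨ value-twos n (ones (2 + n * n)) ⟩
  2 ^ n * (value (ones (2 + n * n)) + 2)   ≡⟨ cong (2 ^ n *_) (trans (+-suc v 1) (cong suc (trans (+-comm v 1) (value-ones (2 + n * n))))) ⟩
  2 ^ n * (1 + 2 ^ (2 + n * n))            ≡⟨ expand (2 ^ n) (2 ^ (n * n)) ⟩
  2 ^ n + (2 * (2 ^ n * 2 ^ (n * n)) + 2 * (2 ^ n * 2 ^ (n * n)))
    ≡⟨ cong (λ k → 2 ^ n + (2 * k + 2 * k)) (sym (^-distribˡ-+-* 2 n (n * n))) ⟩
  2 ^ n + (2 ^ suc (n + n * n) + 2 ^ suc (n + n * n)) ≡⟨ cong (λ k → 2 ^ n + (k + k)) (sym (value-heavy n)) ⟩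
  2 ^ n + (value (heavyNumerator n) + value (heavyNumerator n)) ∎
  where
  open ≡-Reasoning
  v = value (ones (2 + n * n))
  expand : ∀ a b → a * (1 + 2 * (2 * b)) ≡ a + (2 * (a * b) + 2 * (a * b))
  expand = solve-∀

ratio-cong : ∀ a b c d .{{_ : NonZero b}} .{{_ : NonZero d}} → a ≡ c → b ≡ d → ratio a b ≡ ratio c d
ratio-cong a b _ _ refl refl = refl

+-≤⇒≤- : ∀ {p q r} → p ℚ.+ q ℚ.≤ r → p ℚ.≤ r ℚ.- q
+-≤⇒≤- {p} {q} {r} le = ℚ.≤-trans (ℚ.≤-reflexive (sym cancelled)) (ℚ.+-monoˡ-≤ (ℚ.- q) le)
  where
  cancelled : p ℚ.+ q ℚ.- q ≡ p
  cancelled = trans (ℚ.+-assoc p q (ℚ.- q)) (trans (cong (p ℚ.+_) (ℚ.+-inverseʳ q)) (ℚ.+-identityʳ p))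

-- The common interface of both halves of the theorem at one length: `heavy` selects exactly two
-- strings, one on each side of `A`, and `M` classifies both correctly.
record Pierced (A : Language) (M : TM) (heavy : String → Bool) (n : ℕ) : Set where
  field
    {pos neg} : String
    pos-length : length pos ≡ n
    neg-length : length neg ≡ n
    pos∈       : A pos
    neg∉       : ¬ A neg
    accepted   : Accepts M pos
    rejected   : ¬ Accepts M neg
    pos-heavy  : heavy pos ≡ true
    neg-heavy  : heavy neg ≡ true
    only       : ∀ {x} → length x ≡ n → heavy x ≡ true → x ≡ pos ⊎ x ≡ neg

-- The distribution: total mass, dichotomy, balance, error

module _ (A : Language) (M : TM) (N : ℕ) (heavy : String → Bool)
         (pierced : ∀ n → N ≤ n → Pierced A M heavy n) where

  top bottom : ℕ → String → ℕ
  top i x    = proj₁ (mass N heavy (i , x))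
  bottom i x = proj₂ (mass N heavy (i , x))

  heavyMass : ℕ → ℕ
  heavyMass n = value (heavyNumerator n)

  -- Written as a successor so that its NonZero instance is found without unfolding denominator.
  totalMass : ℕ → ℕ
  totalMass n = suc (pred (value (denominator n)))

  massOf : ℕ → String → ℕ
  massOf n x = if heavy x then heavyMass n else 1

  value-nonZero : ∀ c x → NonZero (value (c ∷ x))
  value-nonZero false x = _
  value-nonZero true  x = _

  denominator-nonZero : ∀ n → NonZero (value (denominator n))
  denominator-nonZero zero    = value-nonZero false (ones 1)
  denominator-nonZero (suc n) = value-nonZero true (twos n ++ ones (2 + suc n * suc n))

  totalMass≡ : ∀ n → totalMass n ≡ value (denominator n)
  totalMass≡ n = suc-pred (value (denominator n)) {{denominator-nonZero n}}

  totalMass+2 : ∀ n → totalMass n + 2 ≡ 2 ^ n + (heavyMass n + heavyMass n)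
  totalMass+2 n = trans (cong (_+ 2) (totalMass≡ n)) (value-denominator n)

  massBits-off : ∀ {i x} → length x ≢ i → massBits N heavy i x ≡ ([] , false ∷ [])
  massBits-off {i} {x} x≢ with length x ≟ i
  ... | no _  = refl
  ... | yes p = contradiction p x≢

  massBits-small : ∀ {x} → ¬ N ≤ length x → massBits N heavy (length x) x ≡ (true ∷ [] , smallDenominator (length x))
  massBits-small {x} N≰ with length x ≟ length x
  ... | no ≢ = contradiction refl ≢
  ... | yes _ with N ≤ᵇ length x in eq
  ...   | false = refl
  ...   | true  = contradiction (≤ᵇ⇒≤ N (length x) (subst T (sym eq) _)) N≰

  massBits-large : ∀ {x} → N ≤ length x → massBits N heavy (length x) x ≡
                   ((if heavy x then heavyNumerator (length x) else false ∷ []) , denominator (length x))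
  massBits-large {x} N≤ with length x ≟ length x
  ... | no ≢ = contradiction refl ≢
  ... | yes _ with N ≤ᵇ length x in eq
  ...   | true  = refl
  ...   | false = contradiction (subst T eq (≤⇒≤ᵇ N≤)) (λ ())

  bottom-nonZero : ∀ i x → NonZero (bottom i x)
  bottom-nonZero i x with length x ≟ i
  ... | no _ = _
  ... | yes _ with N ≤ᵇ length x
  ...   | false = value-nonZero true (ones (length x))
  ...   | true  = denominator-nonZero (length x)

  by-size : ∀ n {X : Set} → (N ≤ n → X) → (¬ N ≤ n → X) → X
  by-size n large small with N ≤? n
  ... | yes N≤ = large N≤
  ... | no N≰  = small N≰

  density : ℕ → String → ℚ
  density i x = ratio (top i x) (bottom i x) {{bottom-nonZero i x}}

  density-off : ∀ {i x} → length x ≢ i → density i x ≡ 0ℚ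
  density-off {i} {x} x≢ = ratio-cong (top i x) (bottom i x) 0 1 {{bottom-nonZero i x}}
    (cong (value ∘ proj₁) (massBits-off {i} {x} x≢)) (cong (value ∘ proj₂) (massBits-off {i} {x} x≢))

  density-small : ∀ {n x} → ¬ N ≤ n → length x ≡ n → density n x ≡ ratio 2 (2 ^ suc n) {{m^n≢0 2 (suc n)}}
  density-small {_} {x} N≰ refl =
    ratio-cong (top n x) (bottom n x) 2 (2 ^ suc n) {{bottom-nonZero n x}} {{m^n≢0 2 (suc n)}}
      (cong (value ∘ proj₁) (massBits-small {x} N≰)) (trans (cong (value ∘ proj₂) (massBits-small {x} N≰)) (value-small n))
    where n = length x

  density-large : ∀ {n x} → N ≤ n → length x ≡ n → density n x ≡ ratio (massOf n x) (totalMass n)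
  density-large {_} {x} N≤ refl =
    ratio-cong (top n x) (bottom n x) (massOf n x) (totalMass n) {{bottom-nonZero n x}}
      (trans (cong (value ∘ proj₁) (massBits-large {x} N≤)) (value-if (heavy x)))
      (trans (cong (value ∘ proj₂) (massBits-large {x} N≤)) (sym (totalMass≡ n)))
    where
    n = length x
    value-if : ∀ b → value (if b then heavyNumerator (length x) else false ∷ []) ≡ (if b then heavyMass (length x) else 1)
    value-if true  = refl
    value-if false = refl

  density-≥0 : ∀ i x → 0ℚ ℚ.≤ density i x
  density-≥0 i x = ratio-≤ 0 1 (top i x) (bottom i x) {{_}} {{bottom-nonZero i x}} z≤n

  massOf-heavy : ∀ {n x} → heavy x ≡ true → massOf n x ≡ heavyMass n
  massOf-heavy {n} eq = cong (λ b → if b then heavyMass n else 1) eq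

  -- Adding 1 at `pos` and at `neg` turns the masses, string by string, into the constant 1 plus two
  -- spikes of height K. Both sides can then be summed without subtracting 2 from 2^n.
  tally-massOf : ∀ {n} → N ≤ n → tally (massOf n) (strings n) ≡ totalMass n
  tally-massOf {n} N≤ = +-cancelʳ-≡ 2 (tally (massOf n) xs) (totalMass n) (begin
    tally (massOf n) xs + 2
      ≡⟨ cong (tally (massOf n) xs +_) (sym (cong₂ _+_ (spiked 1 pos-length) (spiked 1 neg-length))) ⟩
    tally (massOf n) xs + (tally (spike 1 pos) xs + tally (spike 1 neg) xs)
      ≡⟨ cong (tally (massOf n) xs +_) (sym (tally-+ (spike 1 pos) (spike 1 neg) xs)) ⟩
    tally (massOf n) xs + tally (λ x → spike 1 pos x + spike 1 neg x) xs
      ≡⟨ sym (tally-+ (massOf n) _ xs) ⟩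
    tally (λ x → massOf n x + (spike 1 pos x + spike 1 neg x)) xs
      ≡⟨ tally-cong (strings-length n) pointwise ⟩
    tally (λ x → 1 + (spike K pos x + spike K neg x)) xs
      ≡⟨ tally-+ (const 1) _ xs ⟩
    tally (const 1) xs + tally (λ x → spike K pos x + spike K neg x) xs
      ≡⟨ cong₂ _+_ (trans (tally-const 1 xs) (trans (+-identityʳ _) (length-strings n))) (tally-+ (spike K pos) (spike K neg) xs) ⟩
    2 ^ n + (tally (spike K pos) xs + tally (spike K neg) xs)
      ≡⟨ cong (2 ^ n +_) (cong₂ _+_ (spiked K pos-length) (spiked K neg-length)) ⟩
    2 ^ n + (K + K)
      ≡⟨ sym (totalMass+2 n) ⟩
    totalMass n + 2 ∎)
    where
    open Pierced (pierced n N≤)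
    open ≡-Reasoning
    xs = strings n
    K  = heavyMass n
    spiked : ∀ k {p} → length p ≡ n → tally (spike k p) xs ≡ k
    spiked k {p} refl = tally-spike k p
    pointwise : ∀ {x} → length x ≡ n → massOf n x + (spike 1 pos x + spike 1 neg x) ≡ 1 + (spike K pos x + spike K neg x)
    pointwise {x} x≡ with x ≟ₛ pos | x ≟ₛ neg
    -- The two heavy strings are distinct because `A` separates them; otherwise the total would be
    -- off.
    ... | yes x≡p | yes x≡n = contradiction pos∈ (subst (¬_ ∘ A) (trans (sym x≡n) x≡p) neg∉)
    ... | yes refl | no _ rewrite pos-heavy = trans (+-comm K 1) (cong suc (sym (+-identityʳ K)))
    ... | no _ | yes refl rewrite neg-heavy = +-comm K 1
    ... | no x≢p | no x≢n with heavy x in eq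
    ...   | false = refl
    ...   | true with only x≡ eq
    ...     | inj₁ x≡p = contradiction x≡p x≢p
    ...     | inj₂ x≡n = contradiction x≡n x≢n

  sum-density : ∀ n → sum (density n) (strings n) ≡ 1ℚ
  sum-density n = by-size n
    (λ N≤ → trans (sum-ratio {f = massOf n} (totalMass n) (strings-length n) (λ {x} → density-large {n} {x} N≤))
      (ratio-≡ (tally (massOf n) (strings n)) (totalMass n) 1 1 (trans (*-identityʳ _) (trans (tally-massOf N≤) (sym (+-identityʳ _))))))
    (λ N≰ → trans (sum-ratio {f = const 2} (2 ^ suc n) {{m^n≢0 2 (suc n)}} (strings-length n) (λ {x} → density-small {n} {x} N≰))
      (ratio-≡ (tally (const 2) (strings n)) (2 ^ suc n) 1 1 {{m^n≢0 2 (suc n)}} (trans (*-identityʳ _)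
        (trans (tally-const 2 (strings n)) (trans (cong (2 *_) (length-strings n)) (sym (+-identityʳ _)))))))

  distribution : Distribution
  distribution = record { μ = density ; nonNegative = density-≥0 ; offLength = λ i x → density-off {i} {x} ; total = sum-density }

  -- With m = n + n² and K = 2^(m+1), the bound is 4K = 2^(3+m), since 2^n ≤ 2K. A light string has
  -- the least weight, 1/D, so this exponent is the polynomial of the dichotomy.
  totalMass-upper : ∀ n → totalMass n ≤ 2 ^ eval (3 ∷ 1 ∷ 1 ∷ []) n
  totalMass-upper n = begin
    totalMass n                                ≤⟨ m≤m+n (totalMass n) 2 ⟩
    totalMass n + 2                            ≡⟨ totalMass+2 n ⟩
    2 ^ n + (heavyMass n + heavyMass n)        ≡⟨ cong (λ k → 2 ^ n + (k + k)) (value-heavy n) ⟩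
    2 ^ n + (2 ^ suc m + 2 ^ suc m)            ≤⟨ +-monoˡ-≤ _ (≤-trans (^-monoʳ-≤ 2 (m≤m+n n (n * n)))
                                                     (≤-trans (m≤n*m (2 ^ m) 4) (≤-reflexive (double (2 ^ m))))) ⟩
    2 ^ suc m + 2 ^ suc m + (2 ^ suc m + 2 ^ suc m) ≡⟨ octuple (2 ^ m) ⟩
    2 ^ (3 + m)                                ≡⟨ cong (2 ^_) (exponent n) ⟩
    2 ^ eval (3 ∷ 1 ∷ 1 ∷ []) n                ∎
    where
    open ≤-Reasoning
    m = n + n * n
    double : ∀ k → 4 * k ≡ 2 * k + 2 * k
    double = solve-∀
    octuple : ∀ k → 2 * k + 2 * k + (2 * k + 2 * k) ≡ 2 * (2 * (2 * k))
    octuple = solve-∀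
    exponent : ∀ n → 3 + (n + n * n) ≡ 3 + n * (1 + n * (1 + n * 0))
    exponent = solve-∀

  massOf≥1 : ∀ n x → 1 ≤ massOf n x
  massOf≥1 n x with heavy x
  ... | false = ≤-refl
  ... | true  = ≤-trans (m^n>0 2 (suc (n + n * n))) (≤-reflexive (sym (value-heavy n)))

  dichotomous : ∀ n x → length x ≡ n → 1/2^ eval (3 ∷ 1 ∷ 1 ∷ []) n ℚ.≤ density n x ⊎ density n x ≡ 0ℚ
  dichotomous n x x≡ = by-size n
    (λ N≤ → inj₁ (subst (1/2^ m ℚ.≤_) (sym (density-large {n} {x} N≤ x≡))
      (ratio-≤ 1 (2 ^ m) (massOf n x) (totalMass n) {{m^n≢0 2 m}} (*-mono-≤ (massOf≥1 n x) (totalMass-upper n)))))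
    (λ N≰ → inj₁ (subst (1/2^ m ℚ.≤_) (sym (density-small {n} {x} N≰ x≡))
      (ratio-≤ 1 (2 ^ m) 2 (2 ^ suc n) {{m^n≢0 2 m}} {{m^n≢0 2 (suc n)}} (*-mono-≤ (s≤s (z≤n {1})) (^-monoʳ-≤ 2 n<m)))))
    where
    m = eval (3 ∷ 1 ∷ 1 ∷ []) n
    n<m : suc n ≤ m
    n<m = s≤s (≤-trans (≤-trans (≤-reflexive (sym (*-identityʳ n))) (*-monoʳ-≤ n (m≤m+n 1 _))) (m≤n+m _ 2))

  density-positive : ∀ x → 0ℚ ℚ.< density (length x) x
  density-positive x = by-size n
    (λ N≤ → subst (0ℚ ℚ.<_) (sym (density-large {n} {x} N≤ refl))
      (ratio-< 0 1 (massOf n x) (totalMass n) (≤-trans (massOf≥1 n x) (≤-reflexive (sym (*-identityʳ _))))))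
    (λ N≰ → subst (0ℚ ℚ.<_) (sym (density-small {n} {x} N≰ refl)) (ratio-< 0 1 2 (2 ^ suc n) {{_}} {{m^n≢0 2 (suc n)}} (s≤s z≤n)))
    where n = length x

  -- Since 2^n ≤ K, the total is at most 3K; this is rounded up to 4K.
  quarter-heavy : ∀ {n x} → N ≤ n → length x ≡ n → heavy x ≡ true → ratio 1 4 ℚ.≤ density n x
  quarter-heavy {n} {x} N≤ x≡ eq = subst (ratio 1 4 ℚ.≤_)
    (sym (trans (density-large {n} {x} N≤ x≡) (cong (λ k → ratio k (totalMass n)) (massOf-heavy {n} {x} eq))))
    (ratio-≤ 1 4 (heavyMass n) (totalMass n) (begin
      1 * totalMass n                      ≡⟨ *-identityˡ (totalMass n) ⟩
      totalMass n                          ≤⟨ m≤m+n (totalMass n) 2 ⟩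
      totalMass n + 2                      ≡⟨ totalMass+2 n ⟩
      2 ^ n + (heavyMass n + heavyMass n)  ≤⟨ +-monoˡ-≤ _ (≤-trans (^-monoʳ-≤ 2 (≤-trans (m≤m+n n (n * n)) (n≤1+n _)))
                                                           (≤-reflexive (sym (value-heavy n)))) ⟩
      heavyMass n + (heavyMass n + heavyMass n) ≤⟨ m≤m+n _ (heavyMass n) ⟩
      heavyMass n + (heavyMass n + heavyMass n) + heavyMass n ≡⟨ four (heavyMass n) ⟩
      heavyMass n * 4                      ∎))
    where
    open ≤-Reasoning
    four : ∀ k → k + (k + k) + k ≡ k * 4
    four = solve-∀

  1<4 : 1ℚ ℚ.< ℤ.+ 4 ℚ./ 1
  1<4 = ℚ.*<* (ℤ.+<+ (s≤s (s≤s z≤n)))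

  balanced : ∀ n → N ≤ n → Prob distribution n A (λ r → 1/⟨ 1<4 ⟩ ℚ.≤ r × r ℚ.≤ 1ℚ ℚ.- 1/⟨ 1<4 ⟩)
  balanced n N≤ A? =
    ℚ.≤-trans (quarter-heavy N≤ pos-length pos-heavy)
      (weight-member (density n) (density-≥0 n) A? (subst (λ m → pos ∈ˢ m) pos-length (∈-strings pos)) pos∈) ,
    -- The upper bound is a lower bound for the complement, witnessed by `neg`.
    +-≤⇒≤- (ℚ.≤-trans (ℚ.+-monoʳ-≤ (weight (density n) A?)
        (ℚ.≤-trans (quarter-heavy N≤ neg-length neg-heavy)
          (weight-member (density n) (density-≥0 n) (ListAll.map ¬? A?) (subst (λ m → neg ∈ˢ m) neg-length (∈-strings neg)) neg∉)))
      (ℚ.≤-reflexive (trans (weight-complement (density n) A?) (sum-density n))))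
    where
    open Pierced (pierced n N≤)
    open import Data.List.Membership.Propositional using (_∈_)
    _∈ˢ_ : String → ℕ → Set
    x ∈ˢ m = x ∈ strings m

  -- `M` is right on both heavy strings, so every error has weight 1/D, and there are at most 2^n of
  -- them.
  errorWeight : ∀ n → N ≤ n → Prob distribution n (Errs A M) (ℚ._≤ ratio (2 ^ n) (totalMass n))
  errorWeight n N≤ E? = ℚ.≤-trans
    (weight-≤ (density n) (totalMass n) E? (strings-length n) light)
    (ℚ.≤-reflexive (cong (λ k → ratio k (totalMass n)) (length-strings n)))
    where
    open Pierced (pierced n N≤)
    light : ∀ {x} → length x ≡ n → Errs A M x → density n x ℚ.≤ ratio 1 (totalMass n)
    light {x} x≡ err = on-heavy (heavy x) refl
      where
      on-heavy : ∀ b → heavy x ≡ b → density n x ℚ.≤ ratio 1 (totalMass n)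
      on-heavy false eq = ℚ.≤-reflexive (trans (density-large {n} {x} N≤ x≡)
                            (cong (λ b → ratio (if b then heavyMass n else 1) (totalMass n)) eq))
      on-heavy true eq = [ (λ { refl → contradiction pos∈ (Equivalence.from err accepted) })
                         , (λ { refl → contradiction (Equivalence.to err neg∉) rejected }) ]′ (only x≡ eq)

  totalMass-lower : ∀ n → 2 ^ (n + n * n) ≤ totalMass n
  totalMass-lower n = +-cancelʳ-≤ 2 (2 ^ m) (totalMass n) (begin
    2 ^ m + 2                            ≤⟨ +-monoʳ-≤ (2 ^ m) (+-mono-≤ (m^n>0 2 m) (m^n>0 2 m)) ⟩
    2 ^ m + (2 ^ m + 2 ^ m)              ≤⟨ m≤m+n _ (2 ^ m) ⟩
    2 ^ m + (2 ^ m + 2 ^ m) + 2 ^ m      ≡⟨ regroup (2 ^ m) ⟩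
    2 ^ suc m + 2 ^ suc m                ≡⟨ cong (λ k → k + k) (sym (value-heavy n)) ⟩
    heavyMass n + heavyMass n            ≤⟨ m≤n+m _ (2 ^ n) ⟩
    2 ^ n + (heavyMass n + heavyMass n)  ≡⟨ sym (totalMass+2 n) ⟩
    totalMass n + 2                      ∎)
    where
    open ≤-Reasoning
    m = n + n * n
    regroup : ∀ k → k + (k + k) + k ≡ 2 * k + 2 * k
    regroup = solve-∀

  -- The error is at most 2^n / 2^(n+n²) = 2^(-n²), so it suffices that the claimed exponent does
  -- not exceed n².
  smallError : ∀ n → N ≤ n → Prob distribution n (Errs A M) (ℚ._≤ 1/2^ (n ^ 2 ∸ n))
  smallError n N≤ E? = ℚ.≤-trans (errorWeight n N≤ E?)
   (ratio-≤ (2 ^ n) (totalMass n) 1 (2 ^ (n ^ 2 ∸ n)) {{_}} {{m^n≢0 2 (n ^ 2 ∸ n)}} (begin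
    2 ^ n * 2 ^ (n ^ 2 ∸ n)   ≡⟨ sym (^-distribˡ-+-* 2 n (n ^ 2 ∸ n)) ⟩
    2 ^ (n + (n ^ 2 ∸ n))     ≤⟨ ^-monoʳ-≤ 2 (+-monoʳ-≤ n (≤-trans (m∸n≤m (n ^ 2) n) (≤-reflexive (cong (n *_) (*-identityʳ n))))) ⟩
    2 ^ (n + n * n)           ≤⟨ totalMass-lower n ⟩
    totalMass n               ≡⟨ sym (*-identityˡ (totalMass n)) ⟩
    1 * totalMass n           ∎))
    where open ≤-Reasoning

-- Choice of the heavy strings

-- The parity of `remaining` reveals the first bit, and halving passes to the tail.
remaining-injective : ∀ x y → length x ≡ length y → remaining x ≡ remaining y → x ≡ y
remaining-injective []          []          _  _  = refl
remaining-injective (true ∷ x)  (true ∷ y)  l≡ r≡ =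
  cong (true ∷_) (remaining-injective x y (suc-injective l≡) (*-cancelˡ-≡ _ _ 2 r≡))
remaining-injective (false ∷ x) (false ∷ y) l≡ r≡ =
  cong (false ∷_) (remaining-injective x y (suc-injective l≡) (*-cancelˡ-≡ _ _ 2 (suc-injective r≡)))
remaining-injective (true ∷ x)  (false ∷ y) _  r≡ = contradiction r≡ (even≢odd (remaining x) (remaining y))
remaining-injective (false ∷ x) (true ∷ y)  _  r≡ = contradiction (sym r≡) (even≢odd (remaining y) (remaining x))

∧-true : ∀ {a b} → a ∧ b ≡ true → a ≡ true × b ≡ true
∧-true {true} eq = refl , eq

∨-true : ∀ {a b} → a ∨ b ≡ true → a ≡ true ⊎ b ≡ true
∨-true {true}  _  = inj₁ refl
∨-true {false} eq = inj₂ eq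

∨-trueˡ : ∀ {a} b → a ≡ true → a ∨ b ≡ true
∨-trueˡ _ refl = refl

∨-trueʳ : ∀ a {b} → b ≡ true → a ∨ b ≡ true
∨-trueʳ true  refl = refl
∨-trueʳ false refl = refl

module _ (b : String → Bool) where

  -- The recursion settles what lies beyond `bump y` first. Only if nothing is found there does
  -- `bump y` itself get its chance, and then it is the last member.
  later-member : ∀ k y → remaining y ≡ k →
                 noneWithin b k y ≡ true ⊎ (∃[ p ] length p ≡ length y × isLast b p ≡ true)
  later-member zero    y r≡ = inj₁ refl
  later-member (suc k) y r≡ with later-member k (bump y) (proj₂ (bump-next y r≡)) | b (bump y) in b≡
  ... | inj₂ (p , p≡ , last) | _     = inj₂ (p , trans p≡ (bump-length y) , last)
  ... | inj₁ none            | false = inj₁ none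
  ... | inj₁ none            | true  = inj₂ (bump y , bump-length y ,
    cong₂ _∧_ b≡ (trans (cong (λ m → noneWithin b m (bump y)) (proj₂ (bump-next y r≡))) none))

  last-exists : ∀ x → b x ≡ true → ∃[ p ] length p ≡ length x × isLast b p ≡ true
  last-exists x b≡ with later-member (remaining x) x refl
  ... | inj₁ none = x , refl , cong₂ _∧_ b≡ none
  ... | inj₂ last = last

  -- Each `bump` lowers `remaining` by one, so counting upwards from x meets the value
  -- `remaining z`; by injectivity it does so at z itself.
  none-later : ∀ k x z → remaining x ≡ k → length z ≡ length x → remaining z < k →
               noneWithin b k x ≡ true → b z ≢ true
  none-later (suc k) x z r≡ l≡ z<k none bz with remaining z ≟ k
  ... | yes z≡k with remaining-injective z (bump x) (trans l≡ (sym (bump-length x))) (trans z≡k (sym (proj₂ (bump-next x r≡))))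
  ...   | refl rewrite bz = contradiction none λ ()
  none-later (suc k) x z r≡ l≡ z<k none bz | no z≢k =
    none-later k (bump x) z (proj₂ (bump-next x r≡)) (trans l≡ (sym (bump-length x)))
      (≤∧≢⇒< (s≤s⁻¹ z<k) z≢k) (proj₂ (∧-true {not (b (bump x))} none)) bz

  last-unique : ∀ {x y} → length x ≡ length y → isLast b x ≡ true → isLast b y ≡ true → x ≡ y
  last-unique {x} {y} l≡ x-last y-last with <-cmp (remaining x) (remaining y)
  ... | tri≈ _ r≡ _ = remaining-injective x y l≡ r≡
  ... | tri< r< _ _ = contradiction (proj₁ (∧-true {b x} x-last)) (none-later (remaining y) y x refl l≡ r< (proj₂ (∧-true {b y} y-last)))
  ... | tri> _ _ r> = contradiction (proj₁ (∧-true {b y} y-last)) (none-later (remaining x) x y refl (sym l≡) r> (proj₂ (∧-true {b x} x-last)))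

-- Assembly of the two halves

module Junta {A : Language} (hard : NPHard A) (M : TM) (polyTime : PolynomialTime M) (N : ℕ)
             (heavy : String → Bool) (pierced : ∀ n → N ≤ n → Pierced A M heavy n) where

  D : Distribution
  D = distribution A M N heavy pierced

  basicJunta : BasicJunta A D
  basicJunta = record
    { hardness  = λ B B∈NP → let f , f-computable , reduces = hard B B∈NP in
                  f , f-computable , λ x → (length (f x) , refl , density-positive A M N heavy pierced (f x)) , proj₂ (reduces x)
    ; balance   = ℤ.+ 4 ℚ./ 1 , 1<4 A M N heavy pierced , N , balanced A M N heavy pierced
    ; dichotomy = 3 ∷ 1 ∷ 1 ∷ [] , dichotomous A M N heavy pierced }

  -- Here q(n) = n. The strict inequality `N < n` ensures n ≥ 1, so that q(n) is nonzero, and n <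
  -- 2^n makes the bound strict.
  errorBelow : ∀ n → N < n → Σ[ nz ∈ NonZero (eval (0 ∷ 1 ∷ []) n) ] Prob D n (Errs A M) (ℚ._< 1/ℕ (eval (0 ∷ 1 ∷ []) n) nz)
  errorBelow n@(suc _) N<n = _ , λ E? → ℚ.≤-<-trans (errorWeight A M N heavy pierced n (<⇒≤ N<n) E?)
    (ratio-< (2 ^ n) (weightSum n) 1 (eval (0 ∷ 1 ∷ []) n) (begin-strict
      2 ^ n * eval (0 ∷ 1 ∷ []) n ≡⟨ cong (2 ^ n *_) (trans (cong (n *_) (cong suc (*-zeroʳ n))) (*-identityʳ n)) ⟩
      2 ^ n * n                   <⟨ *-monoʳ-< (2 ^ n) {{m^n≢0 2 n}} (n<2^n n) ⟩
      2 ^ n * 2 ^ n               ≤⟨ *-monoʳ-≤ (2 ^ n) (^-monoʳ-≤ 2 (m≤m*n n n)) ⟩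
      2 ^ n * 2 ^ (n * n)         ≡⟨ sym (^-distribˡ-+-* 2 n (n * n)) ⟩
      2 ^ (n + n * n)             ≤⟨ totalMass-lower A M N heavy pierced n ⟩
      weightSum n                        ≡⟨ sym (*-identityˡ (weightSum n)) ⟩
      1 * weightSum n                    ∎))
    where
    open ≤-Reasoning
    weightSum = totalMass A M N heavy pierced

  basicHeuristic : BasicHeuristic A D M
  basicHeuristic = record
    { junta          = basicJunta
    ; polynomialTime = polyTime
    ; smallError     = (0 ∷ 1 ∷ []) , here _ , suc N , errorBelow }

  tinyError : ∃[ N ] ∀ n → N ≤ n → Prob D n (Errs A M) (ℚ._≤ 1/2^ (n ^ 2 ∸ n))
  tinyError = N , smallError A M N heavy pierced

  uniformlyComputable : ∀ {T} → ComputableInTime T encodeℕ×String encodeℕ×ℕ (mass N heavy) → UniformlyComputableInTime T D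
  uniformlyComputable computable = mass N heavy , computable , λ i x → bottom-nonZero A M N heavy pierced i x , refl

record Testers (b d : String → Bool) : Set₁ where
  field
    {extra}   : ℕ
    {p q}     : Poly
    {first}   : Frag extra
    {second}  : Frag extra
    decidesᵇ  : Decides first (eval p) b
    decidesᵈ  : Decides second (eval q) d

testers : ∀ {L K} (P : Decidable L) (Q : Decidable K) → Testers (Decidable.member P) (Decidable.member Q)
testers P Q = record { p = P.poly ; q = Q.poly ; decidesᵇ = proj₂ F ; decidesᵈ = proj₂ G }
  where
  module P = Decidable P
  module Q = Decidable Q
  F = padBy {T = eval P.poly} {P.member} Q.extra (P.program , P.decides)
  -- Each machine is padded by the other's number of tapes, so the two sums differ only in their
  -- order.
  G = subst (λ e → Σ[ F ∈ Frag e ] Decides F (eval Q.poly) Q.member) (+-comm P.extra Q.extra)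
            (padBy {T = eval Q.poly} {Q.member} P.extra (Q.program , Q.decides))

module _ {b d : String → Bool} (t : Testers b d) (N : ℕ) where
  open Testers t
  open Growth using (Bounded; bound; successor; _⊕_; identity)

  members-computable : ∃[ r ] ComputableInTime (eval r) encodeℕ×String encodeℕ×ℕ (mass N (λ x → b x ∨ d x))
  members-computable = mass-computable N (λ x → b x ∨ d x) (either (isMember first) (isMember second))
    (either-tests (isMemberTime (eval p) decidesᵇ) (isMemberTime (eval q) decidesᵈ) b d
      (isMember-tests (eval p) decidesᵇ) (isMember-tests (eval q) decidesᵈ))
    (_⊕_ polynomial (isMemberTime-bounded (eval p) decidesᵇ (p , λ _ → ≤-refl))
                    (successor polynomial (isMemberTime-bounded (eval q) decidesᵈ (q , λ _ → ≤-refl))))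
    where open Bounds polynomial

  lasts-computable : ∃[ r ] ComputableInTime (λ n → 2 ^ eval r n) encodeℕ×String encodeℕ×ℕ (mass N (λ x → isLast b x ∨ isLast d x))
  lasts-computable = mass-computable N (λ x → isLast b x ∨ isLast d x) (either (isLastMember first) (isLastMember second))
    (either-tests (isLastTime (eval p) decidesᵇ) (isLastTime (eval q) decidesᵈ) (isLast b) (isLast d)
      (isLast-tests (eval p) decidesᵇ) (isLast-tests (eval q) decidesᵈ))
    (_⊕_ exponential (isLastTime-bounded (eval p) decidesᵇ (eval-bounded p) 2^-bounded)
                     (successor exponential (isLastTime-bounded (eval q) decidesᵈ (eval-bounded q) 2^-bounded)))
    where
    open Bounds exponential
    eval-bounded : ∀ p → Bounded exponential (eval p)
    eval-bounded p = p , λ n → <⇒≤ (n<2^n (eval p n))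
    2^-bounded : Bounded exponential (2 ^_)
    2^-bounded = proj₁ (identity polynomial) , λ n → ^-monoʳ-≤ 2 (proj₂ (identity polynomial) n)

polynomial⇒exponential : ∀ {D} → UniformlyPolynomialTime D → UniformlyExponentialTime D
polynomial⇒exponential (p , f , (M , halts) , values) = p , f ,
  (M , λ a → let t , d , t≤ , r = halts a in t , d , ≤-trans t≤ (<⇒≤ (n<2^n (eval p _))) , r) , values

theorem3p3 : (A : Language) → NPHard A →
    (WellPierced A →
    Σ[ D ∈ Distribution ]
    (BasicJunta A D ×
    (Σ[ M ∈ TM ] (BasicHeuristic A D M ×
    (∃[ N ] ∀ n → N ≤ n → Prob D n (Errs A M) (ℚ._≤ 1/2^ (n ^ 2 ∸ n))))) ×
    UniformlyExponentialTime D)) ×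
    (UniquelyWellPierced A →
    Σ[ D ∈ Distribution ]
    (BasicJunta A D ×
    (Σ[ M ∈ TM ] (BasicHeuristic A D M ×
    (∃[ N ] ∀ n → N ≤ n → Prob D n (Errs A M) (ℚ._≤ 1/2^ (n ^ 2 ∸ n))))) ×
    UniformlyExponentialTime D ×
    UniformlyPolynomialTime D))
theorem3p3 A hard = wellPierced , uniquelyWellPierced
  where
  wellPierced : WellPierced A → _
  wellPierced (Pos , Neg , pos@(M , polyTime , Pos⇔) , neg , Pos⊆A , Neg⊆∁A , N , witnesses) =
    D , basicJunta , (M , basicHeuristic , tinyError) ,
    (let r , c = lasts-computable (testers P Q) N in r , uniformlyComputable {λ n → 2 ^ eval r n} c)
    where
    P = decidable pos
    Q = decidable neg
    module P = Decidable P
    module Q = Decidable Q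
    heavy : String → Bool
    heavy x = isLast P.member x ∨ isLast Q.member x
    pierced : ∀ n → N ≤ n → Pierced A M heavy n
    pierced n N≤ =
      let (x , x≡ , x∈) , (y , y≡ , y∈) = witnesses n N≤
          u , u≡ , u-last = last-exists P.member x (P.complete x x∈)
          v , v≡ , v-last = last-exists Q.member y (Q.complete y y∈)
          u∈ = P.sound u (proj₁ (∧-true {P.member u} u-last))
          v∈ = Q.sound v (proj₁ (∧-true {Q.member v} v-last))
      in record
        { pos-length = trans u≡ x≡
        ; neg-length = trans v≡ y≡
        ; pos∈       = Pos⊆A u∈
        ; neg∉       = Neg⊆∁A v∈
        ; accepted   = Equivalence.to (Pos⇔ u) u∈
        -- The heuristic decides `Pos` instead of `A`; it rejects here because `Pos` lies inside
        -- `A`.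
        ; rejected   = λ acc → Neg⊆∁A v∈ (Pos⊆A (Equivalence.from (Pos⇔ v) acc))
        ; pos-heavy  = ∨-trueˡ (isLast Q.member u) u-last
        ; neg-heavy  = ∨-trueʳ (isLast P.member v) v-last
        ; only       = λ {z} z≡ z-heavy → ⊎-map
            (λ z-last → last-unique P.member (trans z≡ (sym (trans u≡ x≡))) z-last u-last)
            (λ z-last → last-unique Q.member (trans z≡ (sym (trans v≡ y≡))) z-last v-last)
            (∨-true {isLast P.member z} z-heavy) }
    open Junta hard M polyTime N heavy pierced

  uniquelyWellPierced : UniquelyWellPierced A → _
  uniquelyWellPierced (Pos , Neg , pos@(M , polyTime , Pos⇔) , neg , Pos⊆A , Neg⊆∁A , N , witnesses) =
    D , basicJunta , (M , basicHeuristic , tinyError) , polynomial⇒exponential {D} polynomially , polynomially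
    where
    P = decidable pos
    Q = decidable neg
    module P = Decidable P
    module Q = Decidable Q
    heavy : String → Bool
    -- Below `N` this may hold for any number of strings, but `massBits` consults it only from
    -- length `N` on.
    heavy x = P.member x ∨ Q.member x
    pierced : ∀ n → N ≤ n → Pierced A M heavy n
    pierced n N≤ =
      let (u , (u≡ , u∈) , u-only) , (v , (v≡ , v∈) , v-only) = witnesses n N≤
      in record
        { pos-length = u≡
        ; neg-length = v≡
        ; pos∈       = Pos⊆A u∈
        ; neg∉       = Neg⊆∁A v∈
        ; accepted   = Equivalence.to (Pos⇔ u) u∈
        ; rejected   = λ acc → Neg⊆∁A v∈ (Pos⊆A (Equivalence.from (Pos⇔ v) acc))
        ; pos-heavy  = ∨-trueˡ (Q.member u) (P.complete u u∈)
        ; neg-heavy  = ∨-trueʳ (P.member v) (Q.complete v v∈)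
        ; only       = λ {z} z≡ z-heavy → ⊎-map
            (λ z∈ → sym (u-only (z≡ , P.sound z z∈)))
            (λ z∈ → sym (v-only (z≡ , Q.sound z z∈)))
            (∨-true {P.member z} z-heavy) }
    open Junta hard M polyTime N heavy pierced
    polynomially : UniformlyPolynomialTime D
    polynomially = let r , c = members-computable (testers P Q) N in r , uniformlyComputable {eval r} c
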